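{- Let $k\geq 3$ be an odd integer, let $N\geq 1$, let $\chi$ be a quadratic Dirichlet character modulo $N$, and let $f(z)=q+\sum_{n\geq 2}a(n)q^n\in S_k^{new}(\Gamma_0(N),\chi)\cap\mathbb{Z}[[q]]$ be a normalized newform with trivial residual mod $2$ Galois representation. Then: 1. $a(p^{d-1})\neq \pm 1$ for every prime $p\nmid 2N$ and every integer $d\geq 2$. 2. For every integer $n>1$ with $\gcd(n,2N)=1$, $a(n)\neq\pm 1$. 3. If $n>1$ is an integer with $\gcd(n,2N)=1$ and $a(n)=\pm\ell$ for some odd prime $\ell$, then $n=p^{d-1}$ for some prime $p$ and some odd integer $d$ with $d\mid \ell(\ell^2-1)$. If moreover the value $\pm\ell=a(p^{d-1})=u_d(\alpha_p,\beta_p)$ is not defective, then $d$ is an odd prime.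
   Context: $q=e^{2\pi i z}$. The newform $f$ has trivial residual mod $2$ Galois representation if $a(p)$ is even for all primes $p\nmid 2N$. For a prime $p\nmid N$, $\alpha_p,\beta_p$ denote the roots of $x^2-a(p)x+\chi(p)p^{k-1}$, and one has $a(p^{n-1})=u_n(\alpha_p,\beta_p)$, where $u_n(\alpha,\beta)=\frac{\alpha^n-\beta^n}{\alpha-\beta}$. A Lucas pair $(\alpha,\beta)$ is a pair of algebraic integers, roots of a monic quadratic polynomial in $\mathbb{Z}[x]$, such that $\alpha+\beta$ and $\alpha\beta$ are coprime non-zero integers and $\alpha/\beta$ is not a root of unity; the numbers $u_n(\alpha,\beta)$ are its Lucas numbers. A prime $\ell\mid u_n(\alpha,\beta)$ is a primitive prime divisor of $u_n(\alpha,\beta)$ if $\ell\nmid(\alpha-\beta)^2u_1(\alpha,\beta)\cdots u_{n-1}(\alpha,\beta)$. A Lucas number $u_n(\alpha,\beta)$ with $n>2$ is called defective if it has no primitive prime divisor. The paper applies this terminology to the sequences $u_n(\alpha_p,\beta_p)$. -}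

module Defs where

open import Algebra.Bundles using (CommutativeRing)
open import Data.Bool.Base using (if_then_else_)
open import Data.Fin.Base using (Fin; toℕ)
open import Data.Integer.Base as ℤ using (ℤ; 0ℤ; 1ℤ)
import Data.Integer.Properties as ℤ
import Data.Integer.Divisibility as ℤ using (_∣_)
open import Data.Nat.Base as ℕ using (ℕ; zero; suc; _∸_; _!)
import Data.Nat.DivMod as ℕ using (_/_)
import Data.Nat.Properties as ℕ
open import Data.Nat.Coprimality using (Coprime)
open import Data.Nat.Divisibility as ℕ using (_∣_; _∣?_)
open import Data.Nat.GCD using (gcd)
open import Data.Nat.Primality using (Prime)
open import Data.Product.Base using (Σ; _×_; _,_; proj₁; proj₂; ∃; ∃₂; ∃-syntax)
open import Data.Product using (∃!)
open import Data.Rational.Base as ℚ using (ℚ; 0ℚ; 1ℚ; ½; 1/_)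
import Data.Rational.Properties as ℚ
open import Data.Rational.Literals using (fromℤ)
open import Data.Rational.Solver using (module +-*-Solver)
import Data.Rational.Unnormalised.Base as ℚᵘ
open import Data.Sum.Base using (_⊎_; inj₁; inj₂)
open import Function.Base using (_∘_)
open import Level using (0ℓ)
open import Relation.Binary.PropositionalEquality
  using (_≡_; _≢_; refl; sym; trans; cong; cong₂; subst; subst₂)
open import Relation.Nullary using (¬_; Dec; yes; no; does; contradiction)
open import Relation.Nullary.Decidable using (_×-dec_)

------------------------------------------------------------------------
-- Rational estimates

half-pos : ∀ {ε} → 0ℚ ℚ.< ε → 0ℚ ℚ.< ε ℚ.* ½
half-pos {ε} ε>0 =
  ℚ.positive⁻¹ _ ⦃ ℚ.pos*pos⇒pos ε ⦃ ℚ.positive ε>0 ⦄ ½ ⦄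

halves : ∀ ε → ε ℚ.* ½ ℚ.+ ε ℚ.* ½ ≡ ε
halves ε = trans (sym (ℚ.*-distribˡ-+ ε ½ ½)) (ℚ.*-identityʳ ε)

mul-pos : ∀ {p q} → 0ℚ ℚ.< p → 0ℚ ℚ.< q → 0ℚ ℚ.< p ℚ.* q
mul-pos {p} {q} p>0 q>0 =
  ℚ.positive⁻¹ _ ⦃ ℚ.pos*pos⇒pos p ⦃ ℚ.positive p>0 ⦄ q ⦃ ℚ.positive q>0 ⦄ ⦄

add-close : ∀ a b c d ε →
  ℚ.∣ a ℚ.- c ∣ ℚ.< ε ℚ.* ½ → ℚ.∣ b ℚ.- d ∣ ℚ.< ε ℚ.* ½ →
  ℚ.∣ (a ℚ.+ b) ℚ.- (c ℚ.+ d) ∣ ℚ.< ε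
add-close a b c d ε p q = begin-strict
  ℚ.∣ (a ℚ.+ b) ℚ.- (c ℚ.+ d) ∣          ≡⟨ cong ℚ.∣_∣ (solve 4 (λ a b c d →
      (a :+ b) :- (c :+ d) := (a :- c) :+ (b :- d)) refl a b c d) ⟩
  ℚ.∣ (a ℚ.- c) ℚ.+ (b ℚ.- d) ∣          ≤⟨ ℚ.∣p+q∣≤∣p∣+∣q∣ (a ℚ.- c) (b ℚ.- d) ⟩
  ℚ.∣ a ℚ.- c ∣ ℚ.+ ℚ.∣ b ℚ.- d ∣        <⟨ ℚ.+-mono-< p q ⟩
  ε ℚ.* ½ ℚ.+ ε ℚ.* ½                    ≡⟨ halves ε ⟩
  ε                                      ∎
  where open ℚ.≤-Reasoning
        open +-*-Solver

neg-dist : ∀ a b → ℚ.∣ (ℚ.- a) ℚ.- (ℚ.- b) ∣ ≡ ℚ.∣ a ℚ.- b ∣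
neg-dist a b = trans (cong ℚ.∣_∣ (solve 2 (λ a b → (:- a) :- (:- b) := :- (a :- b)) refl a b))
                     (ℚ.∣-p∣≡∣p∣ (a ℚ.- b))
  where open +-*-Solver

sym-dist : ∀ a b → ℚ.∣ a ℚ.- b ∣ ≡ ℚ.∣ b ℚ.- a ∣
sym-dist a b = trans (cong ℚ.∣_∣ (solve 2 (λ a b → a :- b := :- (b :- a)) refl a b))
                     (ℚ.∣-p∣≡∣p∣ (b ℚ.- a))
  where open +-*-Solver

self-dist : ∀ a {ε} → 0ℚ ℚ.< ε → ℚ.∣ a ℚ.- a ∣ ℚ.< ε
self-dist a ε>0 = subst (ℚ._< _) (sym (cong ℚ.∣_∣ (ℚ.+-inverseʳ a))) ε>0

-- the tolerance on the factors which keeps a product within ε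
shrink : (B ε : ℚ) → 0ℚ ℚ.< B → ℚ
shrink B ε B>0 = ε ℚ.* ½ ℚ.* (1/ B) ⦃ ℚ.pos⇒nonZero B ⦃ ℚ.positive B>0 ⦄ ⦄

shrink-pos : ∀ B ε B>0 → 0ℚ ℚ.< ε → 0ℚ ℚ.< shrink B ε B>0
shrink-pos B ε B>0 ε>0 = mul-pos (half-pos ε>0)
  (ℚ.positive⁻¹ _ ⦃ ℚ.1/pos⇒pos B ⦃ ℚ.positive B>0 ⦄ ⦄)

shrink-mul : ∀ B ε B>0 → B ℚ.* shrink B ε B>0 ≡ ε ℚ.* ½
shrink-mul B ε B>0 = begin
  B ℚ.* (ε ℚ.* ½ ℚ.* r)   ≡⟨ solve 3 (λ B e r → B :* (e :* r) := e :* (B :* r)) refl B (ε ℚ.* ½) r ⟩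
  ε ℚ.* ½ ℚ.* (B ℚ.* r)   ≡⟨ cong (ε ℚ.* ½ ℚ.*_) (ℚ.*-inverseʳ B) ⟩
  ε ℚ.* ½ ℚ.* 1ℚ          ≡⟨ ℚ.*-identityʳ _ ⟩
  ε ℚ.* ½                 ∎
  where
  open Relation.Binary.PropositionalEquality.≡-Reasoning
  open +-*-Solver
  instance _ = ℚ.pos⇒nonZero B ⦃ ℚ.positive B>0 ⦄
  r = 1/ B

mul-close : ∀ a b c d B ε (B>0 : 0ℚ ℚ.< B) →
  ℚ.∣ a ∣ ℚ.≤ B → ℚ.∣ d ∣ ℚ.≤ B →
  ℚ.∣ a ℚ.- c ∣ ℚ.< shrink B ε B>0 → ℚ.∣ b ℚ.- d ∣ ℚ.< shrink B ε B>0 →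
  ℚ.∣ a ℚ.* b ℚ.- c ℚ.* d ∣ ℚ.< ε
mul-close a b c d B ε B>0 a≤B d≤B a-c b-d = begin-strict
  ℚ.∣ a ℚ.* b ℚ.- c ℚ.* d ∣
    ≡⟨ cong ℚ.∣_∣ (solve 4 (λ a b c d →
         a :* b :- c :* d := a :* (b :- d) :+ d :* (a :- c)) refl a b c d) ⟩
  ℚ.∣ a ℚ.* (b ℚ.- d) ℚ.+ d ℚ.* (a ℚ.- c) ∣
    ≤⟨ ℚ.∣p+q∣≤∣p∣+∣q∣ (a ℚ.* (b ℚ.- d)) (d ℚ.* (a ℚ.- c)) ⟩
  ℚ.∣ a ℚ.* (b ℚ.- d) ∣ ℚ.+ ℚ.∣ d ℚ.* (a ℚ.- c) ∣
    ≡⟨ cong₂ ℚ._+_ (ℚ.∣p*q∣≡∣p∣*∣q∣ a (b ℚ.- d)) (ℚ.∣p*q∣≡∣p∣*∣q∣ d (a ℚ.- c)) ⟩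
  ℚ.∣ a ∣ ℚ.* ℚ.∣ b ℚ.- d ∣ ℚ.+ ℚ.∣ d ∣ ℚ.* ℚ.∣ a ℚ.- c ∣
    <⟨ ℚ.+-mono-< (bound a≤B b-d) (bound d≤B a-c) ⟩
  B ℚ.* shrink B ε B>0 ℚ.+ B ℚ.* shrink B ε B>0
    ≡⟨ cong₂ ℚ._+_ (shrink-mul B ε B>0) (shrink-mul B ε B>0) ⟩
  ε ℚ.* ½ ℚ.+ ε ℚ.* ½
    ≡⟨ halves ε ⟩
  ε ∎
  where
  open ℚ.≤-Reasoning
  open +-*-Solver
  bound : ∀ {x y} → ℚ.∣ x ∣ ℚ.≤ B → ℚ.∣ y ∣ ℚ.< shrink B ε B>0 →
          ℚ.∣ x ∣ ℚ.* ℚ.∣ y ∣ ℚ.< B ℚ.* shrink B ε B>0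
  bound {x} {y} x≤B y<s = ℚ.≤-<-trans
    (ℚ.*-monoʳ-≤-nonNeg ℚ.∣ y ∣ ⦃ ℚ.∣-∣-nonNeg y ⦄ x≤B)
    (ℚ.*-monoʳ-<-pos B ⦃ ℚ.positive B>0 ⦄ y<s)

1+∣∣-pos : ∀ a → 0ℚ ℚ.< 1ℚ ℚ.+ ℚ.∣ a ∣
1+∣∣-pos a = ℚ.positive⁻¹ _ ⦃ ℚ.pos+nonNeg⇒pos 1ℚ ℚ.∣ a ∣ ⦃ ℚ.∣-∣-nonNeg a ⦄ ⦄

near-bound : ∀ a b → ℚ.∣ a ℚ.- b ∣ ℚ.< 1ℚ → ℚ.∣ a ∣ ℚ.≤ 1ℚ ℚ.+ ℚ.∣ b ∣
near-bound a b close = begin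
  ℚ.∣ a ∣                      ≡⟨ cong ℚ.∣_∣ (solve 2 (λ a b → a := (a :- b) :+ b) refl a b) ⟩
  ℚ.∣ (a ℚ.- b) ℚ.+ b ∣        ≤⟨ ℚ.∣p+q∣≤∣p∣+∣q∣ (a ℚ.- b) b ⟩
  ℚ.∣ a ℚ.- b ∣ ℚ.+ ℚ.∣ b ∣    ≤⟨ ℚ.+-monoˡ-≤ ℚ.∣ b ∣ (ℚ.<⇒≤ close) ⟩
  1ℚ ℚ.+ ℚ.∣ b ∣               ∎
  where open ℚ.≤-Reasoning
        open +-*-Solver

fromℤ-* : ∀ i j → fromℤ (i ℤ.* j) ≡ fromℤ i ℚ.* fromℤ j
fromℤ-* i j = ℚ.toℚᵘ-injective
  (trans′ (ℚᵘ.*≡* refl) (sym′ (ℚ.toℚᵘ-homo-* (fromℤ i) (fromℤ j))))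
  where open import Data.Rational.Unnormalised.Properties
          using () renaming (≃-trans to trans′; ≃-sym to sym′)

fromℤ-sub : ∀ i j → fromℤ (i ℤ.- j) ≡ fromℤ i ℚ.- fromℤ j
fromℤ-sub i j = ℚ.toℚᵘ-injective
  (trans′ (ℚᵘ.*≡* eq)
    (sym′ (trans′ (ℚ.toℚᵘ-homo-+ (fromℤ i) (ℚ.- fromℤ j))
                  (+-congʳ (ℚ.toℚᵘ (fromℤ i)) (ℚ.toℚᵘ-homo‿- (fromℤ j))))))
  where
  open import Data.Rational.Unnormalised.Properties
    using (+-congʳ) renaming (≃-trans to trans′; ≃-sym to sym′)
  eq : (i ℤ.- j) ℤ.* 1ℤ ≡ (i ℤ.* 1ℤ ℤ.+ (ℤ.- j) ℤ.* 1ℤ) ℤ.* 1ℤ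
  eq = cong (ℤ._* 1ℤ) (cong₂ ℤ._+_ (sym (ℤ.*-identityʳ i)) (sym (ℤ.*-identityʳ (ℤ.- j))))

------------------------------------------------------------------------
-- Real numbers, as Cauchy sequences of rationals

Eventually : (ℕ → Set) → Set
Eventually P = ∃[ M ] (∀ n → M ℕ.≤ n → P n)

Cauchy : (ℕ → ℚ) → Set
Cauchy s = ∀ ε → 0ℚ ℚ.< ε →
  ∃[ M ] (∀ m n → M ℕ.≤ m → M ℕ.≤ n → ℚ.∣ s m ℚ.- s n ∣ ℚ.< ε)

record ℝ : Set where
  no-eta-equality
  field
    seq    : ℕ → ℚ
    cauchy : Cauchy seq

open ℝ public

infix 4 _≈ᴿ_ _<ᴿ_ _≤ᴿ_

record _≈ᴿ_ (x y : ℝ) : Set where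
  constructor mk≈
  field
    close : ∀ ε → 0ℚ ℚ.< ε → Eventually (λ n → ℚ.∣ seq x n ℚ.- seq y n ∣ ℚ.< ε)

open _≈ᴿ_ public

both : ∀ {P Q : ℕ → Set} → Eventually P → Eventually Q → Eventually (λ n → P n × Q n)
both (M , p) (M′ , q) = M ℕ.⊔ M′ , λ n le →
  p n (ℕ.≤-trans (ℕ.m≤m⊔n M M′) le) , q n (ℕ.≤-trans (ℕ.m≤n⊔m M M′) le)

bounded : ∀ x → ∃[ B ] (0ℚ ℚ.< B × Eventually (λ n → ℚ.∣ seq x n ∣ ℚ.≤ B))
bounded x =
  let M , c = cauchy x 1ℚ (ℚ.positive⁻¹ 1ℚ)
  in 1ℚ ℚ.+ ℚ.∣ seq x M ∣ , 1+∣∣-pos (seq x M) , M ,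
     λ n le → near-bound (seq x n) (seq x M) (c n M le ℕ.≤-refl)

bounded₂ : ∀ x y → ∃[ B ] (0ℚ ℚ.< B ×
  Eventually (λ n → ℚ.∣ seq x n ∣ ℚ.≤ B × ℚ.∣ seq y n ∣ ℚ.≤ B))
bounded₂ x y =
  let B  , B>0  , M  , p = bounded x
      B′ , B′>0 , M′ , q = bounded y
  in B ℚ.⊔ B′ , ℚ.<-≤-trans B>0 (ℚ.p≤p⊔q B B′) ,
     M ℕ.⊔ M′ , λ n le →
       ℚ.≤-trans (p n (ℕ.≤-trans (ℕ.m≤m⊔n M M′) le)) (ℚ.p≤p⊔q B B′) ,
       ℚ.≤-trans (q n (ℕ.≤-trans (ℕ.m≤n⊔m M M′) le)) (ℚ.p≤q⊔p B B′)

ratᴿ : ℚ → ℝ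
seq    (ratᴿ q) _ = q
cauchy (ratᴿ q) ε ε>0 = 0 , λ _ _ _ _ → self-dist q ε>0

0ᴿ 1ᴿ : ℝ
0ᴿ = ratᴿ 0ℚ
1ᴿ = ratᴿ 1ℚ

infixl 6 _+ᴿ_ _-ᴿ_
infixl 7 _*ᴿ_
infix  8 -ᴿ_

_+ᴿ_ : ℝ → ℝ → ℝ
seq    (x +ᴿ y) n = seq x n ℚ.+ seq y n
cauchy (x +ᴿ y) ε ε>0 =
  let M  , p = cauchy x (ε ℚ.* ½) (half-pos ε>0)
      M′ , q = cauchy y (ε ℚ.* ½) (half-pos ε>0)
  in M ℕ.⊔ M′ , λ m n lm ln → add-close (seq x m) (seq y m) (seq x n) (seq y n) ε
       (p m n (ℕ.≤-trans (ℕ.m≤m⊔n M M′) lm) (ℕ.≤-trans (ℕ.m≤m⊔n M M′) ln))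
       (q m n (ℕ.≤-trans (ℕ.m≤n⊔m M M′) lm) (ℕ.≤-trans (ℕ.m≤n⊔m M M′) ln))

-ᴿ_ : ℝ → ℝ
seq    (-ᴿ x) n = ℚ.- seq x n
cauchy (-ᴿ x) ε ε>0 =
  let M , p = cauchy x ε ε>0
  in M , λ m n lm ln →
       subst (ℚ._< ε) (sym (neg-dist (seq x m) (seq x n))) (p m n lm ln)

_-ᴿ_ : ℝ → ℝ → ℝ
x -ᴿ y = x +ᴿ -ᴿ y

_*ᴿ_ : ℝ → ℝ → ℝ
seq    (x *ᴿ y) n = seq x n ℚ.* seq y n
cauchy (x *ᴿ y) ε ε>0 =
  let B , B>0 , M₀ , bd = bounded₂ x y
      δ>0    = shrink-pos B ε B>0 ε>0
      M₁ , p = cauchy x _ δ>0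
      M₂ , q = cauchy y _ δ>0
      K      = M₀ ℕ.⊔ (M₁ ℕ.⊔ M₂)
      K≥M₀   = ℕ.m≤m⊔n M₀ (M₁ ℕ.⊔ M₂)
      K≥M₁   = ℕ.≤-trans (ℕ.m≤m⊔n M₁ M₂) (ℕ.m≤n⊔m M₀ (M₁ ℕ.⊔ M₂))
      K≥M₂   = ℕ.≤-trans (ℕ.m≤n⊔m M₁ M₂) (ℕ.m≤n⊔m M₀ (M₁ ℕ.⊔ M₂))
  in K , λ m n lm ln → mul-close (seq x m) (seq y m) (seq x n) (seq y n) B ε B>0
       (proj₁ (bd m (ℕ.≤-trans K≥M₀ lm))) (proj₂ (bd n (ℕ.≤-trans K≥M₀ ln)))
       (p m n (ℕ.≤-trans K≥M₁ lm) (ℕ.≤-trans K≥M₁ ln))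
       (q m n (ℕ.≤-trans K≥M₂ lm) (ℕ.≤-trans K≥M₂ ln))

Positiveᴿ : ℝ → Set
Positiveᴿ x = ∃[ δ ] (0ℚ ℚ.< δ × Eventually (λ n → δ ℚ.≤ seq x n))

_<ᴿ_ _≤ᴿ_ : ℝ → ℝ → Set
x <ᴿ y = Positiveᴿ (y -ᴿ x)
x ≤ᴿ y = ¬ (y <ᴿ x)

------------------------------------------------------------------------
-- Ring laws

pointwise : ∀ {x y} → (∀ n → seq x n ≡ seq y n) → x ≈ᴿ y
pointwise {x} {y} eq = mk≈ λ ε ε>0 → 0 , λ n _ →
  subst (λ q → ℚ.∣ seq x n ℚ.- q ∣ ℚ.< ε) (eq n) (self-dist (seq x n) ε>0)

≈ᴿ-refl : ∀ {x} → x ≈ᴿ x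
≈ᴿ-refl = pointwise λ _ → refl

≈ᴿ-sym : ∀ {x y} → x ≈ᴿ y → y ≈ᴿ x
≈ᴿ-sym {x} {y} p = mk≈ λ ε ε>0 → let M , q = close p ε ε>0 in
  M , λ n le → subst (ℚ._< ε) (sym-dist (seq x n) (seq y n)) (q n le)

+ᴿ-cong : ∀ {x x′ y y′} → x ≈ᴿ x′ → y ≈ᴿ y′ → x +ᴿ y ≈ᴿ x′ +ᴿ y′
+ᴿ-cong {x} {x′} {y} {y′} p q = mk≈ λ ε ε>0 →
  let M , r = both (close p (ε ℚ.* ½) (half-pos ε>0)) (close q (ε ℚ.* ½) (half-pos ε>0))
  in M , λ n le → add-close (seq x n) (seq y n) (seq x′ n) (seq y′ n) ε
       (proj₁ (r n le)) (proj₂ (r n le))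

≈ᴿ-trans : ∀ {x y z} → x ≈ᴿ y → y ≈ᴿ z → x ≈ᴿ z
≈ᴿ-trans {x} {y} {z} p q = mk≈ λ ε ε>0 → let M , r = close (+ᴿ-cong p q) ε ε>0 in
  M , λ n le → subst (λ w → ℚ.∣ w ∣ ℚ.< ε)
    (solve 3 (λ x y z → (x :+ y) :- (y :+ z) := x :- z) refl (seq x n) (seq y n) (seq z n))
    (r n le)
  where open +-*-Solver

-ᴿ-cong : ∀ {x y} → x ≈ᴿ y → -ᴿ x ≈ᴿ -ᴿ y
-ᴿ-cong {x} {y} p = mk≈ λ ε ε>0 → let M , q = close p ε ε>0 in
  M , λ n le → subst (ℚ._< ε) (sym (neg-dist (seq x n) (seq y n))) (q n le)

*ᴿ-cong : ∀ {x x′ y y′} → x ≈ᴿ x′ → y ≈ᴿ y′ → x *ᴿ y ≈ᴿ x′ *ᴿ y′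
*ᴿ-cong {x} {x′} {y} {y′} p q = mk≈ λ ε ε>0 →
  let B , B>0 , bd = bounded₂ x y′
      δ>0   = shrink-pos B ε B>0 ε>0
      M , r = both bd (both (close p _ δ>0) (close q _ δ>0))
  in M , λ n le → let (u , v) , (s , t) = r n le in
       mul-close (seq x n) (seq y n) (seq x′ n) (seq y′ n) B ε B>0 u v s t

+ᴿ-assoc : ∀ x y z → (x +ᴿ y) +ᴿ z ≈ᴿ x +ᴿ (y +ᴿ z)
+ᴿ-assoc x y z = pointwise λ n → ℚ.+-assoc (seq x n) (seq y n) (seq z n)

+ᴿ-comm : ∀ x y → x +ᴿ y ≈ᴿ y +ᴿ x
+ᴿ-comm x y = pointwise λ n → ℚ.+-comm (seq x n) (seq y n)

+ᴿ-identityˡ : ∀ x → 0ᴿ +ᴿ x ≈ᴿ x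
+ᴿ-identityˡ x = pointwise λ n → ℚ.+-identityˡ (seq x n)

+ᴿ-identityʳ : ∀ x → x +ᴿ 0ᴿ ≈ᴿ x
+ᴿ-identityʳ x = pointwise λ n → ℚ.+-identityʳ (seq x n)

+ᴿ-inverseˡ : ∀ x → -ᴿ x +ᴿ x ≈ᴿ 0ᴿ
+ᴿ-inverseˡ x = pointwise λ n → ℚ.+-inverseˡ (seq x n)

+ᴿ-inverseʳ : ∀ x → x +ᴿ -ᴿ x ≈ᴿ 0ᴿ
+ᴿ-inverseʳ x = pointwise λ n → ℚ.+-inverseʳ (seq x n)

*ᴿ-assoc : ∀ x y z → (x *ᴿ y) *ᴿ z ≈ᴿ x *ᴿ (y *ᴿ z)
*ᴿ-assoc x y z = pointwise λ n → ℚ.*-assoc (seq x n) (seq y n) (seq z n)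

*ᴿ-comm : ∀ x y → x *ᴿ y ≈ᴿ y *ᴿ x
*ᴿ-comm x y = pointwise λ n → ℚ.*-comm (seq x n) (seq y n)

*ᴿ-identityˡ : ∀ x → 1ᴿ *ᴿ x ≈ᴿ x
*ᴿ-identityˡ x = pointwise λ n → ℚ.*-identityˡ (seq x n)

*ᴿ-identityʳ : ∀ x → x *ᴿ 1ᴿ ≈ᴿ x
*ᴿ-identityʳ x = pointwise λ n → ℚ.*-identityʳ (seq x n)

*ᴿ-distribˡ-+ᴿ : ∀ x y z → x *ᴿ (y +ᴿ z) ≈ᴿ x *ᴿ y +ᴿ x *ᴿ z
*ᴿ-distribˡ-+ᴿ x y z = pointwise λ n → ℚ.*-distribˡ-+ (seq x n) (seq y n) (seq z n)

*ᴿ-distribʳ-+ᴿ : ∀ x y z → (y +ᴿ z) *ᴿ x ≈ᴿ y *ᴿ x +ᴿ z *ᴿ x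
*ᴿ-distribʳ-+ᴿ x y z = pointwise λ n → ℚ.*-distribʳ-+ (seq x n) (seq y n) (seq z n)

ℝ-commutativeRing : CommutativeRing 0ℓ 0ℓ
ℝ-commutativeRing = record
  { Carrier = ℝ
  ; _≈_ = _≈ᴿ_
  ; _+_ = _+ᴿ_
  ; _*_ = _*ᴿ_
  ; -_  = -ᴿ_
  ; 0#  = 0ᴿ
  ; 1#  = 1ᴿ
  ; isCommutativeRing = record
    { isRing = record
      { +-isAbelianGroup = record
        { isGroup = record
          { isMonoid = record
            { isSemigroup = record
              { isMagma = record
                { isEquivalence = record { refl = ≈ᴿ-refl ; sym = ≈ᴿ-sym ; trans = ≈ᴿ-trans }
                ; ∙-cong = +ᴿ-cong
                }
              ; assoc = +ᴿ-assoc
              }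
            ; identity = +ᴿ-identityˡ , +ᴿ-identityʳ
            }
          ; inverse = +ᴿ-inverseˡ , +ᴿ-inverseʳ
          ; ⁻¹-cong = -ᴿ-cong
          }
        ; comm = +ᴿ-comm
        }
      ; *-cong = *ᴿ-cong
      ; *-assoc = *ᴿ-assoc
      ; *-identity = *ᴿ-identityˡ , *ᴿ-identityʳ
      ; distrib = *ᴿ-distribˡ-+ᴿ , *ᴿ-distribʳ-+ᴿ
      }
    ; *-comm = *ᴿ-comm
    }
  }

------------------------------------------------------------------------
-- Positivity and inverses of real numbers

clamp-pos : ∀ q {δ} → 0ℚ ℚ.< δ → ℚ.Positive (q ℚ.⊔ δ)
clamp-pos q {δ} δ>0 = ℚ.positive (ℚ.<-≤-trans δ>0 (ℚ.p≤q⊔p q δ))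

recip : ∀ q δ → 0ℚ ℚ.< δ → ℚ
recip q δ δ>0 = (1/ (q ℚ.⊔ δ)) ⦃ ℚ.pos⇒nonZero (q ℚ.⊔ δ) ⦃ clamp-pos q δ>0 ⦄ ⦄

recip-pos : ∀ q δ δ>0 → ℚ.Positive (recip q δ δ>0)
recip-pos q δ δ>0 = ℚ.1/pos⇒pos (q ℚ.⊔ δ) ⦃ clamp-pos q δ>0 ⦄

recip-inverse : ∀ q δ δ>0 → δ ℚ.≤ q → q ℚ.* recip q δ δ>0 ≡ 1ℚ
recip-inverse q δ δ>0 δ≤q =
  trans (cong (ℚ._* recip q δ δ>0) (sym (ℚ.p≥q⇒p⊔q≡p δ≤q)))
        (ℚ.*-inverseʳ (q ℚ.⊔ δ) ⦃ ℚ.pos⇒nonZero (q ℚ.⊔ δ) ⦃ clamp-pos q δ>0 ⦄ ⦄)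

recip-lower : ∀ q δ δ>0 B (B>0 : 0ℚ ℚ.< B) → δ ℚ.≤ q → q ℚ.≤ B →
  (1/ B) ⦃ ℚ.pos⇒nonZero B ⦃ ℚ.positive B>0 ⦄ ⦄ ℚ.≤ recip q δ δ>0
recip-lower q δ δ>0 B B>0 δ≤q q≤B = ℚ.*-cancelˡ-≤-pos B ⦃ ℚ.positive B>0 ⦄ (begin
  B ℚ.* (1/ B)            ≡⟨ ℚ.*-inverseʳ B ⟩
  1ℚ                      ≡⟨ sym (recip-inverse q δ δ>0 δ≤q) ⟩
  q ℚ.* recip q δ δ>0     ≤⟨ ℚ.*-monoʳ-≤-nonNeg (recip q δ δ>0) ⦃ ℚ.pos⇒nonNeg (recip q δ δ>0) ⦃ recip-pos q δ δ>0 ⦄ ⦄ q≤B ⟩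
  B ℚ.* recip q δ δ>0     ∎)
  where
  open ℚ.≤-Reasoning
  instance _ = ℚ.pos⇒nonZero B ⦃ ℚ.positive B>0 ⦄

recip-close : ∀ p q δ ε δ>0 → δ ℚ.≤ p → δ ℚ.≤ q → ℚ.∣ p ℚ.- q ∣ ℚ.< ε ℚ.* (δ ℚ.* δ) →
  ℚ.∣ recip p δ δ>0 ℚ.- recip q δ δ>0 ∣ ℚ.< ε
recip-close p q δ ε δ>0 δ≤p δ≤q close =
  ℚ.*-cancelʳ-<-nonNeg (p ℚ.* q) ⦃ nn ⦄ (begin-strict
    ℚ.∣ rp ℚ.- rq ∣ ℚ.* (p ℚ.* q)
      ≡⟨ cong (ℚ.∣ rp ℚ.- rq ∣ ℚ.*_) (sym (ℚ.0≤p⇒∣p∣≡p (ℚ.nonNegative⁻¹ _ ⦃ nn ⦄))) ⟩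
    ℚ.∣ rp ℚ.- rq ∣ ℚ.* ℚ.∣ p ℚ.* q ∣
      ≡⟨ sym (ℚ.∣p*q∣≡∣p∣*∣q∣ (rp ℚ.- rq) (p ℚ.* q)) ⟩
    ℚ.∣ (rp ℚ.- rq) ℚ.* (p ℚ.* q) ∣
      ≡⟨ cong ℚ.∣_∣ (solve 4 (λ rp rq p q →
           (rp :- rq) :* (p :* q) := (p :* rp) :* q :- (q :* rq) :* p) refl rp rq p q) ⟩
    ℚ.∣ p ℚ.* rp ℚ.* q ℚ.- q ℚ.* rq ℚ.* p ∣
      ≡⟨ cong₂ (λ s t → ℚ.∣ s ℚ.* q ℚ.- t ℚ.* p ∣)
           (recip-inverse p δ δ>0 δ≤p) (recip-inverse q δ δ>0 δ≤q) ⟩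
    ℚ.∣ 1ℚ ℚ.* q ℚ.- 1ℚ ℚ.* p ∣
      ≡⟨ cong₂ (λ s t → ℚ.∣ s ℚ.- t ∣) (ℚ.*-identityˡ q) (ℚ.*-identityˡ p) ⟩
    ℚ.∣ q ℚ.- p ∣
      ≡⟨ sym-dist q p ⟩
    ℚ.∣ p ℚ.- q ∣
      <⟨ close ⟩
    ε ℚ.* (δ ℚ.* δ)
      ≤⟨ ℚ.*-monoˡ-≤-nonNeg ε ⦃ ℚ.nonNegative ε≥0 ⦄ δδ≤pq ⟩
    ε ℚ.* (p ℚ.* q) ∎)
  where
  open ℚ.≤-Reasoning
  open +-*-Solver
  rp = recip p δ δ>0
  rq = recip q δ δ>0
  p>0 = ℚ.<-≤-trans δ>0 δ≤p
  q>0 = ℚ.<-≤-trans δ>0 δ≤q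
  nn : ℚ.NonNegative (p ℚ.* q)
  nn = ℚ.nonNegative (ℚ.<⇒≤ (mul-pos p>0 q>0))
  δδ≤pq : δ ℚ.* δ ℚ.≤ p ℚ.* q
  δδ≤pq = ℚ.≤-trans (ℚ.*-monoʳ-≤-nonNeg δ ⦃ ℚ.nonNegative (ℚ.<⇒≤ δ>0) ⦄ δ≤p)
                    (ℚ.*-monoˡ-≤-nonNeg p ⦃ ℚ.nonNegative (ℚ.<⇒≤ p>0) ⦄ δ≤q)
  ε≥0 : 0ℚ ℚ.≤ ε
  ε≥0 = ℚ.*-cancelʳ-≤-pos (δ ℚ.* δ) ⦃ ℚ.positive (mul-pos δ>0 δ>0) ⦄
    (subst (ℚ._≤ ε ℚ.* (δ ℚ.* δ)) (sym (ℚ.*-zeroˡ (δ ℚ.* δ)))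
      (ℚ.≤-trans (ℚ.0≤∣p∣ (p ℚ.- q)) (ℚ.<⇒≤ close)))

-- Clamping at the lower bound δ affects only finitely many terms.
invᴿ : (x : ℝ) → Positiveᴿ x → ℝ
seq    (invᴿ x (δ , δ>0 , M₀ , low)) n = recip (seq x n) δ δ>0
cauchy (invᴿ x (δ , δ>0 , M₀ , low)) ε ε>0 =
  let M₁ , c = cauchy x (ε ℚ.* (δ ℚ.* δ)) (mul-pos ε>0 (mul-pos δ>0 δ>0))
      K≥M₀ = ℕ.m≤m⊔n M₀ M₁
      K≥M₁ = ℕ.m≤n⊔m M₀ M₁
  in M₀ ℕ.⊔ M₁ , λ m n lm ln → recip-close (seq x m) (seq x n) δ ε δ>0
       (low m (ℕ.≤-trans K≥M₀ lm)) (low n (ℕ.≤-trans K≥M₀ ln))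
       (c m n (ℕ.≤-trans K≥M₁ lm) (ℕ.≤-trans K≥M₁ ln))

invᴿ-inverse : ∀ x (p : Positiveᴿ x) → x *ᴿ invᴿ x p ≈ᴿ 1ᴿ
invᴿ-inverse x (δ , δ>0 , M , low) = mk≈ λ ε ε>0 → M , λ n le →
  subst (λ q → ℚ.∣ q ℚ.- 1ℚ ∣ ℚ.< ε) (sym (recip-inverse (seq x n) δ δ>0 (low n le)))
    (self-dist 1ℚ ε>0)

Positiveᴿ-inv : ∀ x (p : Positiveᴿ x) → Positiveᴿ (invᴿ x p)
Positiveᴿ-inv x (δ , δ>0 , low) =
  let B , B>0 , bd = bounded x
      M , r = both low bd
  in (1/ B) ⦃ ℚ.pos⇒nonZero B ⦃ ℚ.positive B>0 ⦄ ⦄ ,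
     ℚ.positive⁻¹ _ ⦃ ℚ.1/pos⇒pos B ⦃ ℚ.positive B>0 ⦄ ⦄ ,
     M , λ n le → recip-lower (seq x n) δ δ>0 B B>0 (proj₁ (r n le))
                    (ℚ.≤-trans (p≤∣p∣ (seq x n)) (proj₂ (r n le)))
  where
  p≤∣p∣ : ∀ p → p ℚ.≤ ℚ.∣ p ∣
  p≤∣p∣ p with ℚ.≤-total 0ℚ p
  ... | inj₁ 0≤p = ℚ.≤-reflexive (sym (ℚ.0≤p⇒∣p∣≡p 0≤p))
  ... | inj₂ p≤0 = ℚ.≤-trans p≤0 (ℚ.0≤∣p∣ p)

Positiveᴿ-* : ∀ x y → Positiveᴿ x → Positiveᴿ y → Positiveᴿ (x *ᴿ y)
Positiveᴿ-* x y (δ , δ>0 , p) (δ′ , δ′>0 , q) =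
  let M , r = both p q
  in δ ℚ.* δ′ , mul-pos δ>0 δ′>0 , M , λ n le → ℚ.≤-trans
       (ℚ.*-monoʳ-≤-nonNeg δ′ ⦃ ℚ.nonNegative (ℚ.<⇒≤ δ′>0) ⦄ (proj₁ (r n le)))
       (ℚ.*-monoˡ-≤-nonNeg (seq x n)
         ⦃ ℚ.nonNegative (ℚ.≤-trans (ℚ.<⇒≤ δ>0) (proj₁ (r n le))) ⦄ (proj₂ (r n le)))

Positiveᴿ-resp : ∀ x y → (∀ n → seq x n ≡ seq y n) → Positiveᴿ x → Positiveᴿ y
Positiveᴿ-resp x y eq (δ , δ>0 , M , p) = δ , δ>0 , M , λ n le → subst (δ ℚ.≤_) (eq n) (p n le)

Positiveᴿ-rat : ∀ q → 0ℚ ℚ.< q → Positiveᴿ (ratᴿ q)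
Positiveᴿ-rat q q>0 = q , q>0 , 0 , λ _ _ → ℚ.≤-refl

------------------------------------------------------------------------
-- Complex numbers

record ℂ : Set where
  constructor _+i_
  field
    re im : ℝ

open ℂ public

infix  4 _≈ᶜ_
infixl 6 _+ᶜ_
infixl 7 _*ᶜ_
infix  8 -ᶜ_

record _≈ᶜ_ (w z : ℂ) : Set where
  constructor _+i_
  field
    re≈ : re w ≈ᴿ re z
    im≈ : im w ≈ᴿ im z

open _≈ᶜ_ public

_+ᶜ_ _*ᶜ_ : ℂ → ℂ → ℂ
w +ᶜ z = (re w +ᴿ re z) +i (im w +ᴿ im z)
w *ᶜ z = (re w *ᴿ re z -ᴿ im w *ᴿ im z) +i (re w *ᴿ im z +ᴿ im w *ᴿ re z)

-ᶜ_ conj : ℂ → ℂ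
-ᶜ z = (-ᴿ re z) +i (-ᴿ im z)
conj z = re z +i (-ᴿ im z)

realᶜ : ℝ → ℂ
realᶜ x = x +i 0ᴿ

ratᶜ : ℚ → ℂ
ratᶜ = realᶜ ∘ ratᴿ

intᶜ : ℤ → ℂ
intᶜ = ratᶜ ∘ fromℤ

natᶜ : ℕ → ℂ
natᶜ n = intᶜ (ℤ.+ n)

0ᶜ 1ᶜ : ℂ
0ᶜ = ratᶜ 0ℚ
1ᶜ = ratᶜ 1ℚ

normSq : ℂ → ℝ
normSq z = re z *ᴿ re z +ᴿ im z *ᴿ im z

invᶜ : (z : ℂ) → Positiveᴿ (normSq z) → ℂ
invᶜ z p = conj z *ᶜ realᶜ (invᴿ (normSq z) p)

≈ᶜ-refl : ∀ {z} → z ≈ᶜ z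
≈ᶜ-refl = ≈ᴿ-refl +i ≈ᴿ-refl

≈ᶜ-sym : ∀ {w z} → w ≈ᶜ z → z ≈ᶜ w
≈ᶜ-sym (p +i q) = ≈ᴿ-sym p +i ≈ᴿ-sym q

≈ᶜ-trans : ∀ {w y z} → w ≈ᶜ y → y ≈ᶜ z → w ≈ᶜ z
≈ᶜ-trans (p +i q) (r +i s) = ≈ᴿ-trans p r +i ≈ᴿ-trans q s

+ᶜ-cong : ∀ {w w′ z z′} → w ≈ᶜ w′ → z ≈ᶜ z′ → w +ᶜ z ≈ᶜ w′ +ᶜ z′
+ᶜ-cong (p +i q) (r +i s) = +ᴿ-cong p r +i +ᴿ-cong q s

-ᶜ-cong : ∀ {w z} → w ≈ᶜ z → -ᶜ w ≈ᶜ -ᶜ z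
-ᶜ-cong (p +i q) = -ᴿ-cong p +i -ᴿ-cong q

*ᶜ-cong : ∀ {w w′ z z′} → w ≈ᶜ w′ → z ≈ᶜ z′ → w *ᶜ z ≈ᶜ w′ *ᶜ z′
*ᶜ-cong (p +i q) (r +i s) =
  +ᴿ-cong (*ᴿ-cong p r) (-ᴿ-cong (*ᴿ-cong q s)) +i +ᴿ-cong (*ᴿ-cong p s) (*ᴿ-cong q r)

+ᶜ-assoc : ∀ x y z → (x +ᶜ y) +ᶜ z ≈ᶜ x +ᶜ (y +ᶜ z)
+ᶜ-assoc x y z = +ᴿ-assoc (re x) (re y) (re z) +i +ᴿ-assoc (im x) (im y) (im z)

+ᶜ-comm : ∀ x y → x +ᶜ y ≈ᶜ y +ᶜ x
+ᶜ-comm x y = +ᴿ-comm (re x) (re y) +i +ᴿ-comm (im x) (im y)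

+ᶜ-identityˡ : ∀ x → 0ᶜ +ᶜ x ≈ᶜ x
+ᶜ-identityˡ x = +ᴿ-identityˡ (re x) +i +ᴿ-identityˡ (im x)

+ᶜ-identityʳ : ∀ x → x +ᶜ 0ᶜ ≈ᶜ x
+ᶜ-identityʳ x = +ᴿ-identityʳ (re x) +i +ᴿ-identityʳ (im x)

+ᶜ-inverseˡ : ∀ x → -ᶜ x +ᶜ x ≈ᶜ 0ᶜ
+ᶜ-inverseˡ x = +ᴿ-inverseˡ (re x) +i +ᴿ-inverseˡ (im x)

+ᶜ-inverseʳ : ∀ x → x +ᶜ -ᶜ x ≈ᶜ 0ᶜ
+ᶜ-inverseʳ x = +ᴿ-inverseʳ (re x) +i +ᴿ-inverseʳ (im x)

*ᶜ-assoc : ∀ x y z → (x *ᶜ y) *ᶜ z ≈ᶜ x *ᶜ (y *ᶜ z)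
*ᶜ-assoc (a +i b) (c +i d) (e +i f) =
  (pointwise λ n → solve 6 (λ a b c d e f →
     (a :* c :- b :* d) :* e :- (a :* d :+ b :* c) :* f :=
     a :* (c :* e :- d :* f) :- b :* (c :* f :+ d :* e)) refl
     (seq a n) (seq b n) (seq c n) (seq d n) (seq e n) (seq f n)) +i
  (pointwise λ n → solve 6 (λ a b c d e f →
     (a :* c :- b :* d) :* f :+ (a :* d :+ b :* c) :* e :=
     a :* (c :* f :+ d :* e) :+ b :* (c :* e :- d :* f)) refl
     (seq a n) (seq b n) (seq c n) (seq d n) (seq e n) (seq f n))
  where open +-*-Solver

*ᶜ-comm : ∀ x y → x *ᶜ y ≈ᶜ y *ᶜ x
*ᶜ-comm (a +i b) (c +i d) =
  (pointwise λ n → solve 4 (λ a b c d → a :* c :- b :* d := c :* a :- d :* b) refl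
     (seq a n) (seq b n) (seq c n) (seq d n)) +i
  (pointwise λ n → solve 4 (λ a b c d → a :* d :+ b :* c := c :* b :+ d :* a) refl
     (seq a n) (seq b n) (seq c n) (seq d n))
  where open +-*-Solver

*ᶜ-identityˡ : ∀ x → 1ᶜ *ᶜ x ≈ᶜ x
*ᶜ-identityˡ (a +i b) =
  (pointwise λ n → solve 2 (λ a b → con 1ℚ :* a :- con 0ℚ :* b := a) refl (seq a n) (seq b n)) +i
  (pointwise λ n → solve 2 (λ a b → con 1ℚ :* b :+ con 0ℚ :* a := b) refl (seq a n) (seq b n))
  where open +-*-Solver

*ᶜ-identityʳ : ∀ x → x *ᶜ 1ᶜ ≈ᶜ x
*ᶜ-identityʳ x = ≈ᶜ-trans (*ᶜ-comm x 1ᶜ) (*ᶜ-identityˡ x)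

*ᶜ-distribˡ-+ᶜ : ∀ x y z → x *ᶜ (y +ᶜ z) ≈ᶜ x *ᶜ y +ᶜ x *ᶜ z
*ᶜ-distribˡ-+ᶜ (a +i b) (c +i d) (e +i f) =
  (pointwise λ n → solve 6 (λ a b c d e f →
     a :* (c :+ e) :- b :* (d :+ f) :=
     (a :* c :- b :* d) :+ (a :* e :- b :* f)) refl
     (seq a n) (seq b n) (seq c n) (seq d n) (seq e n) (seq f n)) +i
  (pointwise λ n → solve 6 (λ a b c d e f →
     a :* (d :+ f) :+ b :* (c :+ e) :=
     (a :* d :+ b :* c) :+ (a :* f :+ b :* e)) refl
     (seq a n) (seq b n) (seq c n) (seq d n) (seq e n) (seq f n))
  where open +-*-Solver

*ᶜ-distribʳ-+ᶜ : ∀ x y z → (y +ᶜ z) *ᶜ x ≈ᶜ y *ᶜ x +ᶜ z *ᶜ x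
*ᶜ-distribʳ-+ᶜ x y z = ≈ᶜ-trans (*ᶜ-comm (y +ᶜ z) x)
  (≈ᶜ-trans (*ᶜ-distribˡ-+ᶜ x y z) (+ᶜ-cong (*ᶜ-comm x y) (*ᶜ-comm x z)))

ℂ-commutativeRing : CommutativeRing 0ℓ 0ℓ
ℂ-commutativeRing = record
  { Carrier = ℂ
  ; _≈_ = _≈ᶜ_
  ; _+_ = _+ᶜ_
  ; _*_ = _*ᶜ_
  ; -_  = -ᶜ_
  ; 0#  = 0ᶜ
  ; 1#  = 1ᶜ
  ; isCommutativeRing = record
    { isRing = record
      { +-isAbelianGroup = record
        { isGroup = record
          { isMonoid = record
            { isSemigroup = record
              { isMagma = record
                { isEquivalence = record { refl = ≈ᶜ-refl ; sym = ≈ᶜ-sym ; trans = ≈ᶜ-trans }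
                ; ∙-cong = +ᶜ-cong
                }
              ; assoc = +ᶜ-assoc
              }
            ; identity = +ᶜ-identityˡ , +ᶜ-identityʳ
            }
          ; inverse = +ᶜ-inverseˡ , +ᶜ-inverseʳ
          ; ⁻¹-cong = -ᶜ-cong
          }
        ; comm = +ᶜ-comm
        }
      ; *-cong = *ᶜ-cong
      ; *-assoc = *ᶜ-assoc
      ; *-identity = *ᶜ-identityˡ , *ᶜ-identityʳ
      ; distrib = *ᶜ-distribˡ-+ᶜ , *ᶜ-distribʳ-+ᶜ
      }
    ; *-comm = *ᶜ-comm
    }
  }

module C = CommutativeRing ℂ-commutativeRing
open CommutativeRing ℂ-commutativeRing public
  using (_≈_; _+_; _*_; _-_; -_; semiring; *-commutativeMonoid)
open import Algebra.Properties.Semiring.Exp semiring public using (_^_)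
open import Algebra.Properties.Semiring.Sum semiring public using (sum-syntax; sum-cong-≋; *-distribˡ-sum)
import Algebra.Properties.CommutativeMonoid.Sum *-commutativeMonoid as Product
import Algebra.Properties.Ring C.ring as RingProperties
import Relation.Binary.Reasoning.Setoid as SetoidReasoning

invᶜ-inverse : ∀ z (p : Positiveᴿ (normSq z)) → z * invᶜ z p ≈ 1ᶜ
invᶜ-inverse z p =
  ≈ᴿ-trans
    (pointwise λ n → solve 3 (λ x y r →
      x :* (x :* r :- :- y :* con 0ℚ) :- y :* (x :* con 0ℚ :+ :- y :* r) :=
      (x :* x :+ y :* y) :* r) refl (seq (re z) n) (seq (im z) n) (seq r n))
    (invᴿ-inverse (normSq z) p)
  +i
  (pointwise λ n → solve 3 (λ x y r →
      x :* (x :* con 0ℚ :+ :- y :* r) :+ y :* (x :* r :- :- y :* con 0ℚ) :=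
      con 0ℚ) refl (seq (re z) n) (seq (im z) n) (seq r n))
  where
  open +-*-Solver
  r : ℝ
  r = invᴿ (normSq z) p

∏< : ℕ → (ℕ → ℂ) → ℂ
∏< n f = Product.sum {n} (f ∘ toℕ)

-- ∥ w ∥≤ ε means |w| ≤ ε.
∥_∥≤_ : ℂ → ℚ → Set
∥ w ∥≤ ε = normSq w ≤ᴿ ratᴿ (ε ℚ.* ε)

infix 4 ∥_∥≤_ _⟶_

_⟶_ : (ℕ → ℂ) → ℂ → Set
s ⟶ w = ∀ ε → 0ℚ ℚ.< ε → Eventually (λ n → ∥ s n - w ∥≤ ε)

-- Leibniz: π = 4 - 4/3 + 4/5 - ⋯
IsPi : ℝ → Set
IsPi π = (λ n → ∑[ j < n ] ((- 1ᶜ) ^ toℕ j * ratᶜ (ℤ.+ 4 ℚ./ suc (2 ℕ.* toℕ j)))) ⟶ realᶜ π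

IsExp : ℂ → ℂ → Set
IsExp w v = (λ n → ∑[ j < n ] (ratᶜ ((1ℤ ℚ./ (toℕ j !)) ⦃ toℕ j ℕ.!≢0 ⦄) * w ^ toℕ j)) ⟶ v

------------------------------------------------------------------------
-- The upper half-plane and the action of SL₂(ℤ)

record ℍ : Set where
  constructor mkℍ
  field
    point : ℂ
    im>0  : Positiveᴿ (im point)

open ℍ public

record SL₂ℤ : Set where
  field
    a b c d : ℤ
    det     : a ℤ.* d ℤ.- b ℤ.* c ≡ 1ℤ

cz+d : SL₂ℤ → ℂ → ℂ
cz+d γ z = intᶜ c * z + intᶜ d
  where open SL₂ℤ γ

az+b : SL₂ℤ → ℂ → ℂ
az+b γ z = intᶜ a * z + intᶜ b
  where open SL₂ℤ γ

square-nonneg : ∀ q → 0ℚ ℚ.≤ q ℚ.* q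
square-nonneg q with ℚ.≤-total 0ℚ q
... | inj₁ 0≤q = ℚ.nonNegative⁻¹ _
      ⦃ ℚ.nonNeg*nonNeg⇒nonNeg q ⦃ ℚ.nonNegative 0≤q ⦄ q ⦃ ℚ.nonNegative 0≤q ⦄ ⦄
... | inj₂ q≤0 = ℚ.nonNegative⁻¹ _
      ⦃ ℚ.nonPos*nonPos⇒nonPos q ⦃ ℚ.nonPositive q≤0 ⦄ q ⦃ ℚ.nonPositive q≤0 ⦄ ⦄

square-≥1 : ∀ i → i ≢ 0ℤ → 1ℚ ℚ.≤ fromℤ i ℚ.* fromℤ i
square-≥1 i i≢0 = subst (1ℚ ℚ.≤_) (fromℤ-* i i) (ℚ.*≤* (subst₂ ℤ._≤_
  (sym (ℤ.*-identityʳ 1ℤ)) (sym (ℤ.*-identityʳ (i ℤ.* i))) (1≤i² i i≢0)))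
  where
  1≤i² : ∀ i → i ≢ 0ℤ → 1ℤ ℤ.≤ i ℤ.* i
  1≤i² (ℤ.+ zero)    i≢0 = contradiction refl i≢0
  1≤i² ℤ.+[1+ n ]    _   = ℤ.+≤+ (ℕ.s≤s ℕ.z≤n)
  1≤i² ℤ.-[1+ n ]    _   = ℤ.+≤+ (ℕ.s≤s ℕ.z≤n)

infixr 7 _•_

-- Opaque only to keep normal forms small: the type checker normalises the
-- fields of the records below.
opaque
  cz+d≢0 : ∀ γ (z : ℍ) → Positiveᴿ (normSq (cz+d γ (point z)))
  cz+d≢0 γ (mkℍ z (δ , δ>0 , M , low)) with SL₂ℤ.c γ ℤ.≟ 0ℤ
  ... | no c≢0 = δ ℚ.* δ , mul-pos δ>0 δ>0 , M , bound
    where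
    C : ℚ
    C = fromℤ (SL₂ℤ.c γ)
    bound : ∀ n → M ℕ.≤ n → δ ℚ.* δ ℚ.≤ seq (normSq (cz+d γ z)) n
    bound n le = begin
      δ ℚ.* δ                        ≤⟨ ℚ.*-monoʳ-≤-nonNeg δ ⦃ ℚ.nonNegative (ℚ.<⇒≤ δ>0) ⦄ (low n le) ⟩
      y ℚ.* δ                        ≤⟨ ℚ.*-monoˡ-≤-nonNeg y ⦃ ℚ.nonNegative y≥0 ⦄ (low n le) ⟩
      y ℚ.* y                        ≡⟨ ℚ.*-identityˡ (y ℚ.* y) ⟨
      1ℚ ℚ.* (y ℚ.* y)               ≤⟨ ℚ.*-monoʳ-≤-nonNeg (y ℚ.* y) ⦃ ℚ.nonNegative (square-nonneg y) ⦄
                                          (square-≥1 _ c≢0) ⟩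
      C ℚ.* C ℚ.* (y ℚ.* y)          ≡⟨ solve 3 (λ C x y →
                                          C :* C :* (y :* y) :=
                                          (C :* y :+ con 0ℚ :* x :+ con 0ℚ) :* (C :* y :+ con 0ℚ :* x :+ con 0ℚ))
                                          refl C x y ⟩
      I ℚ.* I                        ≡⟨ ℚ.+-identityˡ (I ℚ.* I) ⟨
      0ℚ ℚ.+ I ℚ.* I                 ≤⟨ ℚ.+-monoˡ-≤ (I ℚ.* I) (square-nonneg R) ⟩
      R ℚ.* R ℚ.+ I ℚ.* I            ∎
      where
      open ℚ.≤-Reasoning
      open +-*-Solver
      x y R I : ℚ
      x = seq (re z) n
      y = seq (im z) n
      R = seq (re (cz+d γ z)) n
      I = seq (im (cz+d γ z)) n
      y≥0 : 0ℚ ℚ.≤ y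
      y≥0 = ℚ.≤-trans (ℚ.<⇒≤ δ>0) (low n le)
  ... | yes c≡0 = 1ℚ , ℚ.positive⁻¹ 1ℚ , 0 , λ n _ → bound n
    where
    open SL₂ℤ γ
    d≢0 : d ≢ 0ℤ
    d≢0 d≡0 with () ← trans (sym det) (cong₂ ℤ._-_
      (trans (cong (a ℤ.*_) d≡0) (ℤ.*-zeroʳ a)) (trans (cong (b ℤ.*_) c≡0) (ℤ.*-zeroʳ b)))
    D : ℚ
    D = fromℤ d
    bound : ∀ n → 1ℚ ℚ.≤ seq (normSq (cz+d γ z)) n
    bound n = begin
      1ℚ                             ≤⟨ square-≥1 d d≢0 ⟩
      D ℚ.* D                        ≡⟨ ℚ.+-identityʳ (D ℚ.* D) ⟨
      D ℚ.* D ℚ.+ 0ℚ                 ≤⟨ ℚ.+-monoʳ-≤ (D ℚ.* D) (square-nonneg I) ⟩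
      D ℚ.* D ℚ.+ I ℚ.* I            ≡⟨ cong (λ r → r ℚ.* r ℚ.+ I ℚ.* I) D≡R ⟩
      R ℚ.* R ℚ.+ I ℚ.* I            ∎
      where
      open ℚ.≤-Reasoning
      open +-*-Solver
      x y R I : ℚ
      x = seq (re z) n
      y = seq (im z) n
      R = seq (re (cz+d γ z)) n
      I = seq (im (cz+d γ z)) n
      D≡R : D ≡ R
      D≡R = trans
        (solve 3 (λ D x y → D := con 0ℚ :* x :- con 0ℚ :* y :+ D) refl D x y)
        (cong (λ i → fromℤ i ℚ.* x ℚ.- 0ℚ ℚ.* y ℚ.+ D) (sym c≡0))

  -- 1/(cz+d)
  cocycle⁻¹ : SL₂ℤ → ℍ → ℂ
  cocycle⁻¹ γ z = invᶜ (cz+d γ (point z)) (cz+d≢0 γ z)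

  •-im>0 : ∀ γ z → Positiveᴿ (im (az+b γ (point z) * cocycle⁻¹ γ z))
  •-im>0 γ z = Positiveᴿ-resp
    (im (point z) *ᴿ invᴿ N N>0) (im (az+b γ (point z) * cocycle⁻¹ γ z)) im≡
    (Positiveᴿ-* (im (point z)) (invᴿ N N>0) (im>0 z) (Positiveᴿ-inv N N>0))
    where
    open SL₂ℤ γ
    N : ℝ
    N   = normSq (cz+d γ (point z))
    N>0 : Positiveᴿ N
    N>0 = cz+d≢0 γ z
    det-ℚ : fromℤ a ℚ.* fromℤ d ℚ.- fromℤ b ℚ.* fromℤ c ≡ 1ℚ
    det-ℚ = trans (cong₂ ℚ._-_ (sym (fromℤ-* a d)) (sym (fromℤ-* b c)))
      (trans (sym (fromℤ-sub (a ℤ.* d) (b ℤ.* c))) (cong fromℤ det))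
    im≡ : ∀ n → seq (im (point z) *ᴿ invᴿ N N>0) n ≡ seq (im (az+b γ (point z) * cocycle⁻¹ γ z)) n
    im≡ n = trans (trans (sym (ℚ.*-identityˡ (y ℚ.* r))) (cong (ℚ._* (y ℚ.* r)) (sym det-ℚ)))
      (solve 7 (λ a b c d x y r →
        (a :* d :- b :* c) :* (y :* r) :=
        (a :* x :- con 0ℚ :* y :+ b) :*
          ((c :* x :- con 0ℚ :* y :+ d) :* con 0ℚ :+ :- (c :* y :+ con 0ℚ :* x :+ con 0ℚ) :* r)
        :+ (a :* y :+ con 0ℚ :* x :+ con 0ℚ) :*
          ((c :* x :- con 0ℚ :* y :+ d) :* r :- :- (c :* y :+ con 0ℚ :* x :+ con 0ℚ) :* con 0ℚ))
        refl (fromℤ a) (fromℤ b) (fromℤ c) (fromℤ d) x y r)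
      where
      open +-*-Solver
      x y r : ℚ
      x = seq (re (point z)) n
      y = seq (im (point z)) n
      r = seq (invᴿ N N>0) n

  _•_ : SL₂ℤ → ℍ → ℍ
  γ • z = mkℍ (az+b γ (point z) * cocycle⁻¹ γ z) (•-im>0 γ z)

------------------------------------------------------------------------
-- Cusp forms

record DirichletCharacter (N : ℕ) : Set where
  field
    eval           : ℤ → ℂ
    periodic       : ∀ m → eval (m ℤ.+ ℤ.+ N) ≈ eval m
    multiplicative : ∀ m n → eval (m ℤ.* n) ≈ eval m * eval n
    at-1           : eval 1ℤ ≈ 1ᶜ
    non-unit       : ∀ m → ¬ Coprime ℤ.∣ m ∣ N → eval m ≈ 0ᶜ

open DirichletCharacter public using (eval)

IsQuadratic : ∀ {N} → DirichletCharacter N → Set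
IsQuadratic χ =
  (∀ m → eval χ m ≈ 0ᶜ ⊎ eval χ m ≈ 1ᶜ ⊎ eval χ m ≈ - 1ᶜ) × ∃[ m ] eval χ m ≈ - 1ᶜ

Induces : ∀ {M N} → DirichletCharacter M → DirichletCharacter N → Set
Induces {M} {N} ψ χ = ∀ m → Coprime ℤ.∣ m ∣ N → eval ψ m ≈ eval χ m

IsHolomorphic : (ℍ → ℂ) → Set
IsHolomorphic f = ∀ z → ∃[ f′ ] (∀ ε → 0ℚ ℚ.< ε → ∃[ δ ] (0ℚ ℚ.< δ ×
  (∀ w → ∥ point w - point z ∥≤ δ →
    normSq (f w - f z - f′ * (point w - point z))
      ≤ᴿ ratᴿ (ε ℚ.* ε) *ᴿ normSq (point w - point z))))

-- (f ∣[ k ] γ) z = (cz+d)⁻ᵏ f(γz)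
_∣[_]_ : (ℍ → ℂ) → ℕ → SL₂ℤ → ℍ → ℂ
(f ∣[ k ] γ) z = cocycle⁻¹ γ z ^ k * f (γ • z)

Γ₀ : ℕ → SL₂ℤ → Set
Γ₀ N γ = ℤ.+ N ℤ.∣ SL₂ℤ.c γ

ZeroAtI∞ : (ℍ → ℂ) → Set
ZeroAtI∞ f = ∀ ε → 0ℚ ℚ.< ε → ∃[ Y ] (∀ z → ratᴿ Y ≤ᴿ im (point z) → ∥ f z ∥≤ ε)

-- SL₂(ℤ) permutes the cusps transitively, so vanishing of every f ∣[ k ] γ
-- at i∞ is vanishing of f at every cusp.
record IsCuspForm (k N : ℕ) (χ : DirichletCharacter N) (f : ℍ → ℂ) : Set where
  field
    holomorphic : IsHolomorphic f
    modular     : ∀ γ → Γ₀ N γ → ∀ z → (f ∣[ k ] γ) z ≈ eval χ (SL₂ℤ.d γ) * f z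
    cuspidal    : ∀ γ → ZeroAtI∞ (f ∣[ k ] γ)

-- f(z) = ∑ c(n) qⁿ with q = exp(2πiz)
HasQExpansion : (ℍ → ℂ) → (ℕ → ℂ) → Set
HasQExpansion f c = ∀ π → IsPi π → ∀ z q → IsExp ((0ᴿ +i (π +ᴿ π)) * point z) q →
  (λ n → ∑[ j < n ] (c (toℕ j) * q ^ toℕ j)) ⟶ f z

------------------------------------------------------------------------
-- The Petersson product

-- γγ′⁻¹ ∈ Γ₀(N), read off from the lower left entry
SameCoset : ℕ → SL₂ℤ → SL₂ℤ → Set
SameCoset N γ γ′ = ℤ.+ N ℤ.∣ (c γ ℤ.* d γ′ ℤ.- d γ ℤ.* c γ′)
  where open SL₂ℤ

IsTransversal : ∀ {r} → ℕ → (Fin r → SL₂ℤ) → Set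
IsTransversal N ρ = ∀ γ → ∃! _≡_ (λ i → SameCoset N γ (ρ i))

opaque
  suc/-pos : ∀ j m .⦃ _ : ℕ.NonZero m ⦄ → 0ℚ ℚ.< ℤ.+ suc j ℚ./ m
  suc/-pos j m = ℚ.positive⁻¹ (ℤ.+ suc j ℚ./ m) ⦃ ℚ.normalize-pos (suc j) m ⦄

ratℍ : (x y : ℚ) → 0ℚ ℚ.< y → ℍ
ratℍ x y y>0 = mkℍ (ratᴿ x +i ratᴿ y) (Positiveᴿ-rat y y>0)

opaque
  -- Riemann sum, of mesh 1/(n+1), for the integral of φ dx dy / y² over
  -- { x + iy : |x| ≤ 1/2, x² + y² ≥ 1, y ≤ T }.  With h = 1/(n+1) and y = (j+1)h
  -- the weight of a grid point is h²/y² = 1/(j+1)².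
  riemannSum : (ℍ → ℂ) → (T n : ℕ) → ℂ
  riemannSum φ T n = ∑[ i < suc (2 ℕ.* m) ] ∑[ j < T ℕ.* m ] term (toℕ i) (toℕ j)
    where
    m : ℕ
    m = suc n
    term : ℕ → ℕ → ℂ
    term i j =
      if does ((ℚ.∣ x ∣ ℚ.≤? ½) ×-dec (1ℚ ℚ.≤? x ℚ.* x ℚ.+ y ℚ.* y))
      then ratᶜ (1ℤ ℚ./ (suc j ℕ.* suc j)) * φ (ratℍ x y (suc/-pos j m))
      else 0ᶜ
      where
      x y : ℚ
      x = (ℤ.+ i ℤ.- ℤ.+ m) ℚ./ m
      y = ℤ.+ suc j ℚ./ m

-- v is the integral over Γ₀(N)\ℍ of f(z) conj(g(z)) Im(z)ᵏ dx dy / y², the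
-- fundamental domain being made of translates of the standard one of SL₂(ℤ).
IsPeterssonProduct : (k N : ℕ) (f g : ℍ → ℂ) (v : ℂ) → Set
IsPeterssonProduct k N f g v = ∃₂ λ r (ρ : Fin r → SL₂ℤ) → IsTransversal N ρ ×
  (∀ ε → 0ℚ ℚ.< ε → ∃[ T₀ ] (∀ T → T₀ ℕ.≤ T → Eventually λ n →
    ∥ ∑[ i < r ] riemannSum (λ z → φ (ρ i • z)) T n - v ∥≤ ε))
  where
  φ : ℍ → ℂ
  φ z = f z * conj (g z) * realᶜ (im (point z)) ^ k

------------------------------------------------------------------------
-- Newforms

opaque
  scale-im>0 : ∀ d .⦃ _ : ℕ.NonZero d ⦄ (z : ℍ) → Positiveᴿ (im (natᶜ d * point z))
  scale-im>0 d@(suc _) (mkℍ z y>0) =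
    Positiveᴿ-resp (ratᴿ (fromℤ (ℤ.+ d)) *ᴿ im z) (im (natᶜ d * z))
      (λ n → solve 3 (λ d x y → d :* y := d :* y :+ con 0ℚ :* x) refl
        (fromℤ (ℤ.+ d)) (seq (re z) n) (seq (im z) n))
      (Positiveᴿ-* (ratᴿ (fromℤ (ℤ.+ d))) (im z)
        (Positiveᴿ-rat (fromℤ (ℤ.+ d)) (ℚ.positive⁻¹ (fromℤ (ℤ.+ d)))) y>0)
    where open +-*-Solver

  scaleℍ : (d : ℕ) .⦃ _ : ℕ.NonZero d ⦄ → ℍ → ℍ
  scaleℍ d z = mkℍ (natᶜ d * point z) (scale-im>0 d z)

-- The span of the forms g(dz), g ∈ S_k(Γ₀(M), ψ), where M is a proper divisor
-- of N, ψ induces χ and dM divides N.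
data IsOldform (k N : ℕ) (χ : DirichletCharacter N) : (ℍ → ℂ) → Set where
  lift  : ∀ {M} (ψ : DirichletCharacter M) {g} (d : ℕ) .⦃ _ : ℕ.NonZero d ⦄ →
          M ≢ N → d ℕ.* M ∣ N → Induces ψ χ → IsCuspForm k M ψ g →
          IsOldform k N χ (λ z → g (scaleℍ d z))
  zero  : IsOldform k N χ (λ _ → 0ᶜ)
  add   : ∀ {g h} → IsOldform k N χ g → IsOldform k N χ h → IsOldform k N χ (λ z → g z + h z)
  scale : ∀ s {g} → IsOldform k N χ g → IsOldform k N χ (λ z → s * g z)

IsInNewspace : (k N : ℕ) → DirichletCharacter N → (ℍ → ℂ) → Set
IsInNewspace k N χ f = ∀ g → IsOldform k N χ g → IsPeterssonProduct k N f g 0ᶜ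

-- Coefficient of qⁿ in T_m (∑ c(n) qⁿ): the sum over d ∣ gcd(m,n) of
-- χ(d) d^(k-1) c(mn/d²), with d = j+1.
hecke : (k : ℕ) {N : ℕ} → DirichletCharacter N → (m : ℕ) → (ℕ → ℂ) → ℕ → ℂ
hecke k χ m c n = ∑[ j < gcd m n ] term (toℕ j)
  where
  term : ℕ → ℂ
  term j =
    if does (suc j ∣? gcd m n)
    then eval χ (ℤ.+ suc j) * natᶜ (suc j) ^ (k ∸ 1) * c ((m ℕ.* n) ℕ./ (suc j ℕ.* suc j))
    else 0ᶜ

record IsNewform (k N : ℕ) (χ : DirichletCharacter N) (f : ℍ → ℂ) (c : ℕ → ℂ) : Set where
  field
    cuspForm   : IsCuspForm k N χ f
    qExpansion : HasQExpansion f c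
    new        : IsInNewspace k N χ f
    eigenform  : ∀ m → 1 ℕ.≤ m → ∃[ μ ] (∀ n → hecke k χ m c n ≈ μ * c n)
    normalized : c 1 ≈ 1ᶜ

TrivialResidualMod2 : ℕ → (ℕ → ℤ) → Set
TrivialResidualMod2 N a = ∀ p → Prime p → ¬ (p ∣ 2 ℕ.* N) → ℤ.+ 2 ℤ.∣ a p

------------------------------------------------------------------------
-- Lucas numbers

AreRootsOf : (α β P Q : ℂ) → Set
AreRootsOf α β P Q = ∀ x → x ^ 2 - P * x + Q ≈ (x - α) * (x - β)

-- α and β are the roots of x² - a(p)x + χ(p)p^(k-1).
AreHeckeRoots : (k : ℕ) {N : ℕ} → DirichletCharacter N → (ℕ → ℤ) → (p : ℕ) → (α β : ℂ) → Set
AreHeckeRoots k χ a p α β =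
  AreRootsOf α β (intᶜ (a p)) (eval χ (ℤ.+ p) * natᶜ p ^ (k ∸ 1))

-- (αⁿ - βⁿ)/(α - β), which as a polynomial in α and β is ∑ αⁱ βⁿ⁻¹⁻ⁱ
lucas : (α β : ℂ) → ℕ → ℂ
lucas α β n = ∑[ i < n ] (α ^ toℕ i * β ^ (n ∸ suc (toℕ i)))

lucas-quotient : ∀ α β n → (α - β) * lucas α β n ≈ α ^ n - β ^ n
lucas-quotient α β zero = begin
  (α - β) * 0ᶜ   ≈⟨ C.zeroʳ (α - β) ⟩
  0ᶜ             ≈⟨ C.-‿inverseʳ 1ᶜ ⟨
  1ᶜ - 1ᶜ        ∎
  where open SetoidReasoning C.setoid
lucas-quotient α β (suc n) = begin
  (α - β) * (1ᶜ * β ^ n + ∑[ i < n ] (α * α ^ toℕ i * β ^ (n ∸ suc (toℕ i))))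
    ≈⟨ C.*-congˡ (C.+-cong (C.*-identityˡ (β ^ n)) shift) ⟩
  (α - β) * (β ^ n + α * lucas α β n)
    ≈⟨ C.distribˡ (α - β) (β ^ n) (α * lucas α β n) ⟩
  (α - β) * β ^ n + (α - β) * (α * lucas α β n)
    ≈⟨ C.+-cong (minus α β (β ^ n)) swap ⟩
  (α * β ^ n - β * β ^ n) + α * ((α - β) * lucas α β n)
    ≈⟨ C.+-congˡ (C.*-congˡ (lucas-quotient α β n)) ⟩
  (α * β ^ n - β * β ^ n) + α * (α ^ n - β ^ n)
    ≈⟨ C.+-congˡ (C.trans (C.*-comm α (α ^ n - β ^ n))
         (C.trans (minus (α ^ n) (β ^ n) α) (C.+-cong (C.*-comm (α ^ n) α) (C.-‿cong (C.*-comm (β ^ n) α))))) ⟩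
  (α * β ^ n - β * β ^ n) + (α * α ^ n - α * β ^ n)
    ≈⟨ C.+-comm (α * β ^ n - β * β ^ n) (α * α ^ n - α * β ^ n) ⟩
  (α * α ^ n - α * β ^ n) + (α * β ^ n - β * β ^ n)
    ≈⟨ C.+-assoc (α * α ^ n) (- (α * β ^ n)) (α * β ^ n - β * β ^ n) ⟩
  α * α ^ n + (- (α * β ^ n) + (α * β ^ n - β * β ^ n))
    ≈⟨ C.+-congˡ (C.+-assoc (- (α * β ^ n)) (α * β ^ n) (- (β * β ^ n))) ⟨
  α * α ^ n + ((- (α * β ^ n) + α * β ^ n) - β * β ^ n)
    ≈⟨ C.+-congˡ (C.trans (C.+-congʳ (C.-‿inverseˡ (α * β ^ n))) (C.+-identityˡ (- (β * β ^ n)))) ⟩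
  α * α ^ n - β * β ^ n ∎
  where
  open SetoidReasoning C.setoid
  minus : ∀ x y z → (x - y) * z ≈ x * z - y * z
  minus x y z = C.trans (C.distribʳ z x (- y))
    (C.+-congˡ (C.sym (RingProperties.-‿distribˡ-* y z)))
  shift : ∑[ i < n ] (α * α ^ toℕ i * β ^ (n ∸ suc (toℕ i))) ≈ α * lucas α β n
  shift = C.trans
    (sum-cong-≋ {n} λ i → C.*-assoc α (α ^ toℕ i) (β ^ (n ∸ suc (toℕ i))))
    (C.sym (*-distribˡ-sum {n} α (λ i → α ^ toℕ i * β ^ (n ∸ suc (toℕ i)))))
  swap : (α - β) * (α * lucas α β n) ≈ α * ((α - β) * lucas α β n)
  swap = C.trans (C.sym (C.*-assoc (α - β) α (lucas α β n)))
    (C.trans (C.*-congʳ (C.*-comm (α - β) α)) (C.*-assoc α (α - β) (lucas α β n)))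

infix 4 _∣ᶜ_

_∣ᶜ_ : ℕ → ℂ → Set
ℓ ∣ᶜ w = ∃[ m ] w ≈ intᶜ (ℤ.+ ℓ ℤ.* m)

IsPrimitiveDivisor : ℕ → (α β : ℂ) → ℕ → Set
IsPrimitiveDivisor ℓ α β n = Prime ℓ × ℓ ∣ᶜ lucas α β n ×
  ¬ (ℓ ∣ᶜ (α - β) ^ 2 * ∏< (n ∸ 1) (λ i → lucas α β (suc i)))

IsDefective : (α β : ℂ) → ℕ → Set
IsDefective α β n = 2 ℕ.< n × ¬ (∃[ ℓ ] IsPrimitiveDivisor ℓ α β n)

{-# OPTIONS --safe #-}
module Submission where

-- For a prime p ∤ 2N the Hecke relations give a(pʳ) = U (r + 1), where U is the
-- Lucas sequence with P = a(p) and Q = χ(p) pᵏ⁻¹.  As P is even, odd values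
-- occur only at odd indices d, and as k - 1 is even, Q = ±b² with b ≥ 2.  For
-- such Q the identity U (2t+1) = U (t+1)² - Q U t² shows that |U d| ≠ 1 for all
-- odd d ≥ 3, with no appeal to primitive divisors.  If d = qr is a proper
-- factorisation, then U d = U r · U′ q, where U′ is the Lucas sequence with
-- parameters V r and Qʳ = ±(bʳ)²; both factors differ from ±1, so |U d| = ℓ
-- forces d to be prime whether or not U d is defective.  The law of apparition
-- ℓ ∣ U (ℓ-1) U ℓ U (ℓ+1) and the gcd property of U then give d ∣ ℓ (ℓ² - 1).
-- Multiplicativity reduces general n to prime powers.

open import Defs using (ℂ; ℍ; DirichletCharacter; IsQuadratic; IsNewform; intᶜ; TrivialResidualMod2; AreHeckeRoots; IsDefective)
open import Data.Fin.Base using (Fin; zero; suc; toℕ; fromℕ; inject₁)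
open import Data.Fin.Properties using (toℕ-fromℕ; toℕ-inject₁; toℕ<n)
import Data.Integer.Properties as ℤ
open import Data.Integer.Tactic.RingSolver using (solve-∀)
open import Data.Nat.Base as ℕ using (ℕ; zero; suc; _∸_; z≤n; s≤s)
open import Data.Nat.Coprimality using (Coprime; coprime-Bézout; coprime-divisor; coprime⇒gcd≡1; gcd≡1⇒coprime)
import Data.Nat.Divisibility as ℕ
open import Data.Nat.GCD using (module Bézout; gcd; gcd-greatest; gcd[m,n]∣m; gcd[m,n]∣n)
open import Data.Nat.Primality
  using (Prime; prime; euclidsLemma; prime⇒irreducible; prime⇒nonTrivial; prime⇒nonZero; ¬prime[0]; ¬prime[1])
import Data.Nat.Properties as ℕ
open import Data.Product.Base using (_×_; _,_; ∃₂; ∃-syntax; proj₂)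
open import Data.Sum.Base as Sum using (_⊎_; inj₁; inj₂; [_,_])
open import Function.Base using (_∘_; id)
open import Relation.Binary.PropositionalEquality
  using (_≡_; _≢_; refl; sym; trans; cong; cong₂; subst; subst₂; isEquivalence; module ≡-Reasoning)
import Relation.Binary.Reasoning.Setoid as SetoidReasoning
open import Relation.Nullary using (¬_; yes; no; does; contradiction)

module LucasSequences where

  open import Algebra.Bundles using (CommutativeSemiring)
  import Algebra.Properties.CommutativeMonoid.Mult
  import Algebra.Properties.CommutativeSemiring.Binomial
  import Algebra.Properties.Monoid.Sum
  import Algebra.Properties.Semiring.Exp
  open import Algebra.Structures.Biased using (isCommutativeMonoidˡ; isCommutativeSemiringˡ)
  open import Data.Empty using (⊥-elim)
  open import Data.Integer.Base using (ℤ; +_; -[1+_]; 0ℤ; 1ℤ; ∣_∣; _+_; _-_; -_; _*_; _^_)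
  open import Data.Integer.Divisibility.Signed
    using (_∣_; _∣?_; divides; ∣ᵤ⇒∣; ∣⇒∣ᵤ; ∣-refl; ∣-trans; ∣m∣n⇒∣m+n; ∣m∣n⇒∣m-n;
           ∣m⇒∣m*n; ∣n⇒∣m*n; *-monoʳ-∣; *-monoˡ-∣)
  open import Data.Nat.Combinatorics using (_C_; nCn≡1; nC1≡n; k>n⇒nCk≡0; nCk+nC[k+1]≡[n+1]C[k+1])
  import Data.Nat.Tactic.RingSolver as ℕ-Tactic
  open import Data.Vec.Functional using (Vector)
  open import Level using (0ℓ)

  -- Divisibility of integers by a prime.

  euclidsLemmaℤ : ∀ {ℓ} → Prime ℓ → ∀ x y → + ℓ ∣ x * y → (+ ℓ ∣ x) ⊎ (+ ℓ ∣ y)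
  euclidsLemmaℤ ℓ-prime x y ℓ∣xy =
    Sum.map ∣ᵤ⇒∣ ∣ᵤ⇒∣ (euclidsLemma ∣ x ∣ ∣ y ∣ ℓ-prime
      (subst (_ ℕ.∣_) (ℤ.abs-* x y) (∣⇒∣ᵤ ℓ∣xy)))

  prime∤1 : ∀ {ℓ} → Prime ℓ → ¬ (+ ℓ ∣ 1ℤ)
  prime∤1 ℓ-prime ℓ∣1 =
    ℕ.nonTrivial⇒≢1 ⦃ prime⇒nonTrivial ℓ-prime ⦄ (ℕ.∣1⇒≡1 (∣⇒∣ᵤ ℓ∣1))

  ∣m-n∧∣m⇒∣n : ∀ {i} m n → i ∣ m - n → i ∣ m → i ∣ n
  ∣m-n∧∣m⇒∣n {i} m n i∣m-n i∣m = subst (i ∣_) (cancel m n) (∣m∣n⇒∣m-n i∣m i∣m-n)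
    where
    cancel : ∀ m n → m - (m - n) ≡ n
    cancel = solve-∀

  ∣m-n∧∣n⇒∣m : ∀ {i} m n → i ∣ m - n → i ∣ n → i ∣ m
  ∣m-n∧∣n⇒∣m {i} m n i∣m-n i∣n = subst (i ∣_) (cancel m n) (∣m∣n⇒∣m+n i∣m-n i∣n)
    where
    cancel : ∀ m n → m - n + n ≡ m
    cancel = solve-∀

  -- Identities and divisibility within one Lucas sequence.

  module Lucas (P Q : ℤ) where

    U : ℕ → ℤ
    U 0             = 0ℤ
    U 1             = 1ℤ
    U (suc (suc n)) = P * U (suc n) - Q * U n

    -- The companion sequence αⁿ + βⁿ of the roots α, β of x² - P x + Q. Written through `U`, it
    -- keeps the identities below polynomial in two consecutive terms.
    V : ℕ → ℤ
    V n = + 2 * U (suc n) - P * U n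

    -- Induction on `m`, moving one step of the recurrence from `m` to `n`.
    U-+ : ∀ m n → U (suc (m ℕ.+ n)) ≡ U (suc m) * U (suc n) - Q * U m * U n
    U-+ zero    n = base Q (U n) (U (suc n))
      where
      base : ∀ q y₀ y₁ → y₁ ≡ 1ℤ * y₁ - q * 0ℤ * y₀
      base = solve-∀
    U-+ (suc m) n = begin
      U (suc (suc m ℕ.+ n))                                     ≡⟨ cong (U ∘ suc) (ℕ.+-suc m n) ⟨
      U (suc (m ℕ.+ suc n))                                     ≡⟨ U-+ m (suc n) ⟩
      x₁ * (P * y₁ - Q * y₀) - Q * x₀ * y₁                      ≡⟨ step P Q x₀ x₁ y₀ y₁ ⟩
      (P * x₁ - Q * x₀) * y₁ - Q * x₁ * y₀                      ∎
      where
      open ≡-Reasoning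
      step : ∀ p q x₀ x₁ y₀ y₁ →
        x₁ * (p * y₁ - q * y₀) - q * x₀ * y₁ ≡ (p * x₁ - q * x₀) * y₁ - q * x₁ * y₀
      step = solve-∀
      x₀ = U m
      x₁ = U (suc m)
      y₀ = U n
      y₁ = U (suc n)

    -- The left side is a determinant of consecutive terms; one step of the recurrence multiplies it
    -- by `Q`.
    cassini : ∀ n → U (suc n) * U (suc n) - U n * U (suc (suc n)) ≡ Q ^ n
    cassini zero    = base P Q
      where
      base : ∀ p q → 1ℤ * 1ℤ - 0ℤ * (p * 1ℤ - q * 0ℤ) ≡ 1ℤ
      base = solve-∀
    cassini (suc n) = begin
      (P * x₁ - Q * x₀) * (P * x₁ - Q * x₀) - x₁ * (P * (P * x₁ - Q * x₀) - Q * x₁)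
        ≡⟨ step P Q x₀ x₁ ⟩
      Q * (x₁ * x₁ - x₀ * (P * x₁ - Q * x₀))
        ≡⟨ cong (Q *_) (cassini n) ⟩
      Q * Q ^ n ∎
      where
      open ≡-Reasoning
      step : ∀ p q x₀ x₁ →
        (p * x₁ - q * x₀) * (p * x₁ - q * x₀) - x₁ * (p * (p * x₁ - q * x₀) - q * x₁) ≡
        q * (x₁ * x₁ - x₀ * (p * x₁ - q * x₀))
      step = solve-∀
      x₀ = U n
      x₁ = U (suc n)

    -- This is α²ⁿ - β²ⁿ = (αⁿ + βⁿ)(αⁿ - βⁿ), divided by α - β.
    U-double : ∀ n → U (n ℕ.+ n) ≡ V n * U n
    U-double zero    = sym (ℤ.*-zeroʳ (V 0))
    U-double (suc n) = begin
      U (suc (n ℕ.+ suc n))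
        ≡⟨ U-+ n (suc n) ⟩
      x₁ * (P * x₁ - Q * x₀) - Q * x₀ * x₁
        ≡⟨ step P Q x₀ x₁ ⟩
      (+ 2 * (P * x₁ - Q * x₀) - P * x₁) * x₁ ∎
      where
      open ≡-Reasoning
      step : ∀ p q x₀ x₁ →
        x₁ * (p * x₁ - q * x₀) - q * x₀ * x₁ ≡ (+ 2 * (p * x₁ - q * x₀) - p * x₁) * x₁
      step = solve-∀
      x₀ = U n
      x₁ = U (suc n)

    -- The powers αʳ and βʳ have sum `V r` and product `Q ^ r`, so terms `r` apart satisfy the
    -- recurrence with these parameters. As functions of `n` both sides obey the original
    -- recurrence; the start values come from `U-double`, and from `U-+` with `cassini`.
    U-shift : ∀ r n → U (n ℕ.+ (r ℕ.+ r)) ≡ V r * U (n ℕ.+ r) - Q ^ r * U n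
    U-shift r zero = begin
      U (r ℕ.+ r)                   ≡⟨ U-double r ⟩
      V r * U r                     ≡⟨ base (V r * U r) (Q ^ r) ⟩
      V r * U r - Q ^ r * 0ℤ        ∎
      where
      open ≡-Reasoning
      base : ∀ x q → x ≡ x - q * 0ℤ
      base = solve-∀
    U-shift r (suc zero) = begin
      U (suc (r ℕ.+ r))
        ≡⟨ U-+ r r ⟩
      x₁ * x₁ - Q * x₀ * x₀
        ≡⟨ base P Q x₀ x₁ ⟩
      (+ 2 * x₁ - P * x₀) * x₁ - (x₁ * x₁ - x₀ * (P * x₁ - Q * x₀)) * 1ℤ
        ≡⟨ cong (λ q → V r * x₁ - q * 1ℤ) (cassini r) ⟩
      V r * U (suc r) - Q ^ r * 1ℤ ∎
      where
      open ≡-Reasoning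
      base : ∀ p q x₀ x₁ → x₁ * x₁ - q * x₀ * x₀ ≡
        (+ 2 * x₁ - p * x₀) * x₁ - (x₁ * x₁ - x₀ * (p * x₁ - q * x₀)) * 1ℤ
      base = solve-∀
      x₀ = U r
      x₁ = U (suc r)
    U-shift r (suc (suc n)) = begin
      P * U (suc n ℕ.+ (r ℕ.+ r)) - Q * U (n ℕ.+ (r ℕ.+ r))
        ≡⟨ cong₂ (λ x y → P * x - Q * y) (U-shift r (suc n)) (U-shift r n) ⟩
      P * (v * x₁ - q * y₁) - Q * (v * x₀ - q * y₀)
        ≡⟨ step P Q v q x₀ x₁ y₀ y₁ ⟩
      v * (P * x₁ - Q * x₀) - q * (P * y₁ - Q * y₀) ∎
      where
      open ≡-Reasoning
      step : ∀ p q v w x₀ x₁ y₀ y₁ → p * (v * x₁ - w * y₁) - q * (v * x₀ - w * y₀) ≡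
        v * (p * x₁ - q * x₀) - w * (p * y₁ - q * y₀)
      step = solve-∀
      v = V r
      q = Q ^ r
      x₀ = U (n ℕ.+ r)
      x₁ = U (suc n ℕ.+ r)
      y₀ = U n
      y₁ = U (suc n)

    -- For even `P`, U (n+2) ≡ Q U n modulo 2, and U 0 = 0.
    U-even : + 2 ∣ P → ∀ k → + 2 ∣ U (k ℕ.* 2)
    U-even 2∣P zero    = divides 0ℤ refl
    U-even 2∣P (suc k) =
      ∣m∣n⇒∣m-n (∣m⇒∣m*n (U (suc (k ℕ.* 2))) 2∣P) (∣n⇒∣m*n Q (U-even 2∣P k))

    ∣P∧∣Q⇒∣U : ∀ {i} → i ∣ P → i ∣ Q → ∀ n → i ∣ U (suc (suc n))
    ∣P∧∣Q⇒∣U i∣P i∣Q n = ∣m∣n⇒∣m-n (∣m⇒∣m*n (U (suc n)) i∣P) (∣m⇒∣m*n (U n) i∣Q)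

    -- In U (n+3) = P U (n+2) - Q U (n+1) the first product has two factors divisible by `i`. The
    -- index starts at 3 because U 2 = P carries only one factor `i`.
    ∣P∧∣Q⇒i²∣U : ∀ {i} → i ∣ P → i * i ∣ Q → ∀ n → i * i ∣ U (suc (suc (suc n)))
    ∣P∧∣Q⇒i²∣U {i} i∣P i²∣Q n = ∣m∣n⇒∣m-n
      (∣-trans (*-monoˡ-∣ i i∣P) (*-monoʳ-∣ P (∣P∧∣Q⇒∣U i∣P (∣-trans (∣m⇒∣m*n i ∣-refl) i²∣Q) n)))
      (∣m⇒∣m*n (U (suc n)) i²∣Q)

    module _ {ℓ} (ℓ-prime : Prime ℓ) where

      -- Modulo ℓ the recurrence collapses to U (n+2) ≡ P U (n+1), so U (n+1) ≡ Pⁿ.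
      ∣Q∧∣U⇒∣P : + ℓ ∣ Q → ∀ n → + ℓ ∣ U (suc n) → + ℓ ∣ P
      ∣Q∧∣U⇒∣P ℓ∣Q zero    ℓ∣1 = contradiction ℓ∣1 (prime∤1 ℓ-prime)
      ∣Q∧∣U⇒∣P ℓ∣Q (suc n) ℓ∣U = [ id , ∣Q∧∣U⇒∣P ℓ∣Q n ] (euclidsLemmaℤ ℓ-prime P (U (suc n))
        (∣m-n∧∣n⇒∣m (P * U (suc n)) (Q * U n) ℓ∣U (∣m⇒∣m*n (U n) ℓ∣Q)))

      module _ (ℓ∤Q : ¬ (+ ℓ ∣ Q)) where

        -- Descent: if ℓ divides two consecutive terms it divides `Q` times the preceding one, hence
        -- that term, and finally U 1 = 1.
        ¬∣U∧∣U-suc : ∀ n → + ℓ ∣ U n → ¬ (+ ℓ ∣ U (suc n))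
        ¬∣U∧∣U-suc zero    _    ℓ∣1  = prime∤1 ℓ-prime ℓ∣1
        ¬∣U∧∣U-suc (suc n) ℓ∣U₁ ℓ∣U₂ =
          [ ℓ∤Q , (λ ℓ∣U₀ → ¬∣U∧∣U-suc n ℓ∣U₀ ℓ∣U₁) ] (euclidsLemmaℤ ℓ-prime Q (U n)
            (∣m-n∧∣m⇒∣n (P * U (suc n)) (Q * U n) ℓ∣U₂ (∣n⇒∣m*n P ℓ∣U₁)))

        -- In the addition formula for U (m+n) the term containing U m drops out modulo ℓ. What
        -- remains is Q U (m-1) U n, where ℓ divides neither `Q` nor the neighbour U (m-1).
        ∣U-cancel : ∀ m n → + ℓ ∣ U m → + ℓ ∣ U (m ℕ.+ n) → + ℓ ∣ U n
        ∣U-cancel zero    n _    ℓ∣Un  = ℓ∣Un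
        ∣U-cancel (suc m) n ℓ∣Um ℓ∣Umn =
          [ [ (λ ℓ∣Q → contradiction ℓ∣Q ℓ∤Q)
            , (λ ℓ∣Um′ → contradiction ℓ∣Um (¬∣U∧∣U-suc m ℓ∣Um′))
            ] ∘ euclidsLemmaℤ ℓ-prime Q (U m)
          , id
          ] (euclidsLemmaℤ ℓ-prime (Q * U m) (U n)
            (∣m-n∧∣m⇒∣n (U (suc m) * U (suc n)) (Q * U m * U n)
              (subst (+ ℓ ∣_) (U-+ m n) ℓ∣Umn) (∣m⇒∣m*n (U (suc n)) ℓ∣Um)))

  -- Composition of indices and common divisors.

  open Lucas public

  -- By `U-shift` the terms at multiples of `r` follow the recurrence with parameters `V r` and
  -- `Q ^ r`; they start with 0 and U r, which is U r times the start 0, 1 of the new Lucas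
  -- sequence.
  U-* : ∀ P Q r s → U P Q (s ℕ.* r) ≡ U P Q r * U (V P Q r) (Q ^ r) s
  U-* P Q r zero       = sym (ℤ.*-zeroʳ (U P Q r))
  U-* P Q r (suc zero) = trans (cong (U P Q) (ℕ.+-identityʳ r)) (sym (ℤ.*-identityʳ (U P Q r)))
  U-* P Q r (suc (suc s)) = begin
    U P Q (r ℕ.+ (r ℕ.+ s ℕ.* r))
      ≡⟨ cong (U P Q) (trans (sym (ℕ.+-assoc r r (s ℕ.* r))) (ℕ.+-comm (r ℕ.+ r) (s ℕ.* r))) ⟩
    U P Q (s ℕ.* r ℕ.+ (r ℕ.+ r))
      ≡⟨ U-shift P Q r (s ℕ.* r) ⟩
    v * U P Q (s ℕ.* r ℕ.+ r) - q * U P Q (s ℕ.* r)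
      ≡⟨ cong₂ (λ x y → v * x - q * y)
           (trans (cong (U P Q) (ℕ.+-comm (s ℕ.* r) r)) (U-* P Q r (suc s))) (U-* P Q r s) ⟩
    v * (u * w₁) - q * (u * w₀)
      ≡⟨ step v q u w₀ w₁ ⟩
    u * (v * w₁ - q * w₀) ∎
    where
    open ≡-Reasoning
    step : ∀ v q u w₀ w₁ → v * (u * w₁) - q * (u * w₀) ≡ u * (v * w₁ - q * w₀)
    step = solve-∀
    v = V P Q r
    q = Q ^ r
    u = U P Q r
    w₀ = U v q s
    w₁ = U v q (suc s)

  ∣⇒∣U : ∀ P Q {ℓ r m} → r ℕ.∣ m → ℓ ∣ U P Q r → ℓ ∣ U P Q m
  ∣⇒∣U P Q {r = r} (ℕ.divides s refl) ℓ∣U =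
    subst (_ ∣_) (sym (U-* P Q r s)) (∣m⇒∣m*n (U (V P Q r) (Q ^ r) s) ℓ∣U)

  -- The indices n with ℓ ∣ U n are closed under multiples and differences, hence
  -- under greatest common divisors.
  ∣U⇒¬coprime : ∀ P Q {ℓ m n} → Prime ℓ → ¬ (+ ℓ ∣ Q) →
    + ℓ ∣ U P Q m → + ℓ ∣ U P Q n → ¬ Coprime m n
  ∣U⇒¬coprime P Q {ℓ} {m} {n} ℓ-prime ℓ∤Q ℓ∣Um ℓ∣Un m⊥n =
    prime∤1 ℓ-prime (go (coprime-Bézout m⊥n))
    where
    go : Bézout.Identity 1 m n → + ℓ ∣ 1ℤ
    -- Bézout writes 1 as a difference of a multiple of `m` and a multiple of `n`, so cancelling
    -- indices yields ℓ ∣ U 1 = 1.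
    go (Bézout.+- x y 1+yn≡xm) = ∣U-cancel P Q ℓ-prime ℓ∤Q (y ℕ.* n) 1
      (∣⇒∣U P Q (ℕ.n∣m*n y) ℓ∣Un)
      (subst (λ i → + ℓ ∣ U P Q i) (trans (sym 1+yn≡xm) (ℕ.+-comm 1 (y ℕ.* n)))
        (∣⇒∣U P Q (ℕ.n∣m*n x) ℓ∣Um))
    go (Bézout.-+ x y 1+xm≡yn) = ∣U-cancel P Q ℓ-prime ℓ∤Q (x ℕ.* m) 1
      (∣⇒∣U P Q (ℕ.n∣m*n x) ℓ∣Um)
      (subst (λ i → + ℓ ∣ U P Q i) (trans (sym 1+xm≡yn) (ℕ.+-comm 1 (x ℕ.* m)))
        (∣⇒∣U P Q (ℕ.n∣m*n y) ℓ∣Un))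

  -- As `d` is prime, gcd(d, m) is 1 or `d`, and coprime indices have just been excluded.
  ∣U⇒∣index : ∀ P Q {ℓ d m} → Prime ℓ → ¬ (+ ℓ ∣ Q) → Prime d →
    + ℓ ∣ U P Q d → + ℓ ∣ U P Q m → d ℕ.∣ m
  ∣U⇒∣index P Q {ℓ} {d} {m} ℓ-prime ℓ∤Q d-prime ℓ∣Ud ℓ∣Um
    with prime⇒irreducible d-prime (gcd[m,n]∣m d m)
  ... | inj₁ gcd≡1 = ⊥-elim (∣U⇒¬coprime P Q {m = d} {m} ℓ-prime ℓ∤Q ℓ∣Ud ℓ∣Um (gcd≡1⇒coprime gcd≡1))
  ... | inj₂ gcd≡d = subst (ℕ._∣ m) gcd≡d (gcd[m,n]∣n d m)

  -- The values ±1 at odd indices.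

  ∣i∣²≡i² : ∀ i → + (∣ i ∣ ℕ.* ∣ i ∣) ≡ i * i
  ∣i∣²≡i² (+ n)    = ℤ.pos-* n n
  ∣i∣²≡i² -[1+ n ] = refl

  -- For Q = b² the form factors as (x + by)(x - by); both factors are ±1, so their difference 2by
  -- is at most 2 in absolute value. For Q = -b² it is x² + (by)² = 1. Either way b|y| ≤ 1, and b ≥
  -- 2 leaves only y = 0.
  ∣x²-Qy²∣≡1⇒y≡0 : ∀ Q x y b → ∣ Q ∣ ≡ b ℕ.* b → 2 ℕ.≤ b → ∣ x * x - Q * y * y ∣ ≡ 1 → y ≡ 0ℤ
  ∣x²-Qy²∣≡1⇒y≡0 Q x y b ∣Q∣≡b² 2≤b unit = ℤ.∣i∣≡0⇒i≡0 (go Q ∣Q∣≡b² unit)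
    where
    small : ∀ z → b ℕ.* z ℕ.≤ 1 → z ≡ 0
    small zero    _  = refl
    small (suc z) le = contradiction (ℕ.≤-trans 2≤b (ℕ.≤-trans (ℕ.m≤m*n b (suc z)) le)) λ { (s≤s ()) }
    go : ∀ Q → ∣ Q ∣ ≡ b ℕ.* b → ∣ x * x - Q * y * y ∣ ≡ 1 → ∣ y ∣ ≡ 0
    go (+ _) refl unit = small ∣ y ∣ (ℕ.*-cancelˡ-≤ 2 (begin
      2 ℕ.* (b ℕ.* ∣ y ∣)                   ≡⟨ cong (2 ℕ.*_) (ℤ.abs-* (+ b) y) ⟨
      2 ℕ.* ∣ + b * y ∣                     ≡⟨ ℤ.abs-* (+ 2) (+ b * y) ⟨
      ∣ + 2 * (+ b * y) ∣                   ≡⟨ cong ∣_∣ (difference x (+ b) y) ⟩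
      ∣ s - t ∣                             ≤⟨ ℤ.∣i-j∣≤∣i∣+∣j∣ s t ⟩
      ∣ s ∣ ℕ.+ ∣ t ∣                       ≡⟨ cong₂ ℕ._+_ (ℕ.m*n≡1⇒m≡1 ∣ s ∣ ∣ t ∣ st≡1)
                                                            (ℕ.m*n≡1⇒n≡1 ∣ s ∣ ∣ t ∣ st≡1) ⟩
      2                                     ∎))
      where
      open ℕ.≤-Reasoning
      s = x + + b * y
      t = x - + b * y
      difference : ∀ x b y → + 2 * (b * y) ≡ (x + b * y) - (x - b * y)
      difference = solve-∀
      factor : ∀ x b y → (x + b * y) * (x - b * y) ≡ x * x - b * b * y * y
      factor = solve-∀
      st≡1 : ∣ s ∣ ℕ.* ∣ t ∣ ≡ 1
      st≡1 = trans (sym (ℤ.abs-* s t)) (trans (cong ∣_∣ (trans (factor x (+ b) y)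
        (cong (λ q → x * x - q * y * y) (sym (ℤ.pos-* b b))))) unit)
    go Q@(-[1+ n ]) 1+n≡b² unit = small ∣ y ∣ (begin
      b ℕ.* ∣ y ∣                                             ≤⟨ m≤m² (b ℕ.* ∣ y ∣) ⟩
      b ℕ.* ∣ y ∣ ℕ.* (b ℕ.* ∣ y ∣)                           ≡⟨ by²≡ ⟩
      suc n ℕ.* (∣ y ∣ ℕ.* ∣ y ∣)                             ≤⟨ ℕ.m≤n+m _ (∣ x ∣ ℕ.* ∣ x ∣) ⟩
      ∣ x ∣ ℕ.* ∣ x ∣ ℕ.+ suc n ℕ.* (∣ y ∣ ℕ.* ∣ y ∣)         ≡⟨ trans (cong ∣_∣ sum≡) unit ⟩
      1 ∎)
      where
      open ℕ.≤-Reasoning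
      m≤m² : ∀ m → m ℕ.≤ m ℕ.* m
      m≤m² zero    = z≤n
      m≤m² (suc m) = ℕ.m≤m*n (suc m) (suc m)
      by²≡ : b ℕ.* ∣ y ∣ ℕ.* (b ℕ.* ∣ y ∣) ≡ suc n ℕ.* (∣ y ∣ ℕ.* ∣ y ∣)
      by²≡ = trans (ℕ.[m*n]*[o*p]≡[m*o]*[n*p] b (∣ y ∣) b (∣ y ∣))
        (cong (ℕ._* (∣ y ∣ ℕ.* ∣ y ∣)) (sym 1+n≡b²))
      minus : ∀ x q y → x * x + q * (y * y) ≡ x * x - (- q) * y * y
      minus = solve-∀
      sum≡ : + (∣ x ∣ ℕ.* ∣ x ∣ ℕ.+ suc n ℕ.* (∣ y ∣ ℕ.* ∣ y ∣)) ≡ x * x - Q * y * y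
      sum≡ = trans (cong₂ (λ u v → u + v) (∣i∣²≡i² x)
        (trans (ℤ.pos-* (suc n) (∣ y ∣ ℕ.* ∣ y ∣)) (cong (+ suc n *_) (∣i∣²≡i² y)))) (minus x (+ suc n) y)

  module _ (P Q : ℤ) {b : ℕ} (∣Q∣≡b² : ∣ Q ∣ ≡ b ℕ.* b) (2≤b : 2 ℕ.≤ b) where

    -- U (2t+1) = U (t+1)² - Q U t² with Q = ±b², so |U (2t+1)| = 1 forces U t = 0
    -- and |U (t+1)| = 1, while U t = 0 makes U (t+1) a multiple of Q.
    ∣U-odd∣≢1 : ∀ t → ∣ U P Q (3 ℕ.+ t ℕ.* 2) ∣ ≢ 1
    ∣U-odd∣≢1 t unit = ℕ.<⇒≢ (ℕ.≤-trans (s≤s (s≤s z≤n)) (ℕ.*-mono-≤ 2≤b 2≤b))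
      (trans (sym ∣Q∣≡1) ∣Q∣≡b²)
      where
      -- The index 3 + 2t is 2(t+1) + 1, so `x` and `y` are the two terms in the quadratic form; `z`
      -- enters through x = P y - Q z.
      x = U P Q (suc (suc t))
      y = U P Q (suc t)
      z = U P Q t
      index : ∀ t → 3 ℕ.+ t ℕ.* 2 ≡ suc (suc t ℕ.+ suc t)
      index = ℕ-Tactic.solve-∀
      U≡ : U P Q (3 ℕ.+ t ℕ.* 2) ≡ x * x - Q * y * y
      U≡ = trans (cong (U P Q) (index t)) (U-+ P Q (suc t) (suc t))
      y≡0 : y ≡ 0ℤ
      y≡0 = ∣x²-Qy²∣≡1⇒y≡0 Q x y b ∣Q∣≡b² 2≤b (trans (cong ∣_∣ (sym U≡)) unit)
      drop₁ : ∀ x q → x ≡ x - q * 0ℤ * 0ℤ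
      drop₁ = solve-∀
      drop₂ : ∀ p w → p * 0ℤ - w ≡ - w
      drop₂ = solve-∀
      x²≡U : x * x ≡ U P Q (3 ℕ.+ t ℕ.* 2)
      x²≡U = trans (drop₁ (x * x) Q) (trans (cong (λ y → x * x - Q * y * y) (sym y≡0)) (sym U≡))
      ∣x∣≡1 : ∣ x ∣ ≡ 1
      ∣x∣≡1 = ℕ.m*n≡1⇒m≡1 ∣ x ∣ ∣ x ∣ (trans (sym (ℤ.abs-* x x)) (trans (cong ∣_∣ x²≡U) unit))
      x≡-Qz : x ≡ - (Q * z)
      x≡-Qz = trans (cong (λ y → P * y - Q * z) y≡0) (drop₂ P (Q * z))
      ∣Q∣≡1 : ∣ Q ∣ ≡ 1
      ∣Q∣≡1 = ℕ.m*n≡1⇒m≡1 ∣ Q ∣ ∣ z ∣ (begin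
        ∣ Q ∣ ℕ.* ∣ z ∣     ≡⟨ ℤ.abs-* Q z ⟨
        ∣ Q * z ∣           ≡⟨ ℤ.∣-i∣≡∣i∣ (Q * z) ⟨
        ∣ - (Q * z) ∣       ≡⟨ cong ∣_∣ x≡-Qz ⟨
        ∣ x ∣               ≡⟨ ∣x∣≡1 ⟩
        1                   ∎)
        where open ≡-Reasoning

  -- Binomial coefficients, the Frobenius congruence and Fermat's little theorem.

  [1+k]*[1+n]C[1+k]≡[1+n]*nCk : ∀ n k → suc k ℕ.* (suc n C suc k) ≡ suc n ℕ.* (n C k)
  [1+k]*[1+n]C[1+k]≡[1+n]*nCk n zero = begin
    1 ℕ.* (suc n C 1)       ≡⟨ ℕ.*-identityˡ (suc n C 1) ⟩
    suc n C 1               ≡⟨ nC1≡n (suc n) ⟩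
    suc n                   ≡⟨ ℕ.*-identityʳ (suc n) ⟨
    suc n ℕ.* 1             ∎
    where open ≡-Reasoning
  [1+k]*[1+n]C[1+k]≡[1+n]*nCk zero (suc k) = begin
    suc (suc k) ℕ.* (1 C suc (suc k))
      ≡⟨ cong (suc (suc k) ℕ.*_) (k>n⇒nCk≡0 {1} {suc (suc k)} (s≤s (s≤s z≤n))) ⟩
    suc (suc k) ℕ.* 0                    ≡⟨ ℕ.*-zeroʳ (suc (suc k)) ⟩
    0                                    ≡⟨ cong (1 ℕ.*_) (k>n⇒nCk≡0 {0} {suc k} (s≤s z≤n)) ⟨
    1 ℕ.* (0 C suc k)                    ∎
    where open ≡-Reasoning
  [1+k]*[1+n]C[1+k]≡[1+n]*nCk (suc n) (suc k) = begin
    suc (suc k) ℕ.* (suc (suc n) C suc (suc k))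
      ≡⟨ cong (suc (suc k) ℕ.*_) (nCk+nC[k+1]≡[n+1]C[k+1] (suc n) (suc k)) ⟨
    suc (suc k) ℕ.* (c ℕ.+ d)
      ≡⟨ split k c d ⟩
    c ℕ.+ (suc k ℕ.* c ℕ.+ suc (suc k) ℕ.* d)
      ≡⟨ cong (c ℕ.+_) (cong₂ ℕ._+_ ([1+k]*[1+n]C[1+k]≡[1+n]*nCk n k)
                                    ([1+k]*[1+n]C[1+k]≡[1+n]*nCk n (suc k))) ⟩
    c ℕ.+ (suc n ℕ.* (n C k) ℕ.+ suc n ℕ.* (n C suc k))
      ≡⟨ cong (c ℕ.+_) (ℕ.*-distribˡ-+ (suc n) (n C k) (n C suc k)) ⟨
    c ℕ.+ suc n ℕ.* (n C k ℕ.+ n C suc k)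
      ≡⟨ cong (λ e → c ℕ.+ suc n ℕ.* e) (nCk+nC[k+1]≡[n+1]C[k+1] n k) ⟩
    suc (suc n) ℕ.* c ∎
    where
    open ≡-Reasoning
    c = suc n C suc k
    d = suc n C suc (suc k)
    split : ∀ k c d → suc (suc k) ℕ.* (c ℕ.+ d) ≡ c ℕ.+ (suc k ℕ.* c ℕ.+ suc (suc k) ℕ.* d)
    split = ℕ-Tactic.solve-∀

  -- By the absorption identity p divides (k+1) C(p, k+1), and it cannot divide k+1 < p.
  prime∣pCk : ∀ {p k} → Prime p → suc k ℕ.< p → p ℕ.∣ p C suc k
  prime∣pCk {suc n} {k} p-prime k<p with euclidsLemma (suc k) (suc n C suc k) p-prime
    (ℕ.divides (n C k) (trans ([1+k]*[1+n]C[1+k]≡[1+n]*nCk n k) (ℕ.*-comm (suc n) (n C k))))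
  ... | inj₁ p∣1+k = contradiction (ℕ.∣⇒≤ p∣1+k) (ℕ.<⇒≱ k<p)
  ... | inj₂ p∣C   = p∣C

  module _ {c ℓ} (R : CommutativeSemiring c ℓ) where
    private
      module R where
        open CommutativeSemiring R public
        open Algebra.Properties.Semiring.Exp semiring public
        open Algebra.Properties.CommutativeMonoid.Mult +-commutativeMonoid public
        open Algebra.Properties.Monoid.Sum +-monoid public using (sum; sum-init-last)
        open Algebra.Properties.CommutativeSemiring.Binomial R public
      open R using (Carrier; _≈_)
      open SetoidReasoning R.setoid

    sum-multiple : ∀ p {n} (t : Vector Carrier n) → (∀ i → ∃[ z ] t i ≈ p R.× z) →
      ∃[ z ] R.sum t ≈ p R.× z
    sum-multiple p {zero}  t t∣ = R.0# , R.sym (nil p)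
      where
      nil : ∀ n → n R.× R.0# ≈ R.0#
      nil zero    = R.refl
      nil (suc n) = R.trans (R.+-identityˡ (n R.× R.0#)) (nil n)
    sum-multiple p {suc n} t t∣ =
      let z , t₀≈ = t∣ zero
          w , Σt≈ = sum-multiple p (t ∘ suc) (t∣ ∘ suc)
      in z R.+ w , R.trans (R.+-cong t₀≈ Σt≈) (R.sym (R.×-distrib-+ z w p))

    -- All terms of the binomial expansion except the two outer ones have coefficients divisible by
    -- `p`. The general semiring covers both ℤ and `ℤ[α]`, and the witness `z` expresses the
    -- congruence modulo `p`.
    frobenius : ∀ {p} → Prime p → ∀ x y → ∃[ z ] (x R.+ y) R.^ p ≈ (x R.^ p R.+ y R.^ p) R.+ p R.× z
    frobenius {p@(suc n)} p-prime x y =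
      let z , middle = sum-multiple p (t ∘ suc ∘ inject₁) multiple
      in z , (begin
        (x R.+ y) R.^ p                                          ≈⟨ R.theorem p x y ⟩
        t zero R.+ R.sum (t ∘ suc)                               ≈⟨ R.+-congˡ (R.sum-init-last (t ∘ suc)) ⟩
        t zero R.+ (R.sum (t ∘ suc ∘ inject₁) R.+ t (suc (fromℕ n)))
          ≈⟨ R.+-cong first (R.+-cong middle final) ⟩
        y R.^ p R.+ (p R.× z R.+ x R.^ p)                        ≈⟨ R.+-comm _ _ ⟩
        (p R.× z R.+ x R.^ p) R.+ y R.^ p                        ≈⟨ R.+-assoc _ _ _ ⟩
        p R.× z R.+ (x R.^ p R.+ y R.^ p)                        ≈⟨ R.+-comm _ _ ⟩
        (x R.^ p R.+ y R.^ p) R.+ p R.× z                        ∎)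
      where
      t : Vector Carrier (suc p)
      t = R.binomialTerm x y p
      first : t zero ≈ y R.^ p
      first = R.trans (R.×-homo-1 _) (R.*-identityˡ (y R.^ p))
      final : t (suc (fromℕ n)) ≈ x R.^ p
      final = begin
        (p C suc (toℕ (fromℕ n))) R.× (x R.^ suc (toℕ (fromℕ n)) R.* y R.^ (n ℕ.∸ toℕ (fromℕ n)))
          ≡⟨ cong (λ m → (p C suc m) R.× (x R.^ suc m R.* y R.^ (n ℕ.∸ m))) (toℕ-fromℕ n) ⟩
        (p C p) R.× (x R.^ p R.* y R.^ (n ℕ.∸ n))
          ≡⟨ cong₂ (λ c m → c R.× (x R.^ p R.* y R.^ m)) (nCn≡1 p) (ℕ.n∸n≡0 n) ⟩
        1 R.× (x R.^ p R.* R.1#)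
          ≈⟨ R.×-homo-1 _ ⟩
        x R.^ p R.* R.1#
          ≈⟨ R.*-identityʳ _ ⟩
        x R.^ p ∎
      multiple : ∀ i → ∃[ z ] t (suc (inject₁ i)) ≈ p R.× z
      multiple i = go (prime∣pCk p-prime (s≤s (subst (ℕ._< n) (sym (toℕ-inject₁ i)) (toℕ<n i))))
        where
        b = R.binomial x y p (suc (inject₁ i))
        go : p ℕ.∣ (p C suc (toℕ (inject₁ i))) → ∃[ z ] t (suc (inject₁ i)) ≈ p R.× z
        go (ℕ.divides q eq) = q R.× b , (begin
          (p C suc (toℕ (inject₁ i))) R.× b   ≡⟨ cong (R._× b) (trans eq (ℕ.*-comm q p)) ⟩
          (p ℕ.* q) R.× b                     ≈⟨ R.×-assocˡ b p q ⟨
          p R.× (q R.× b)                     ∎)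

  -- Frobenius with x = 1 gives the induction step for natural numbers; Frobenius applied to x +
  -- (-x) = 0 transfers the result to negative ones.
  fermat : ∀ {p} → Prime p → ∀ x → + p ∣ x ^ p - x
  fermat {p@(suc p-1)} p-prime = go
    where
    module E = Algebra.Properties.Semiring.Exp ℤ.+-*-semiring
    module M = Algebra.Properties.CommutativeMonoid.Mult ℤ.+-0-commutativeMonoid
    ^≡ : ∀ x n → x E.^ n ≡ x ^ n
    ^≡ x zero    = refl
    ^≡ x (suc n) = cong (x *_) (^≡ x n)
    ×≡ : ∀ n z → n M.× z ≡ z * + n
    ×≡ zero    z = sym (ℤ.*-zeroʳ z)
    ×≡ (suc n) z = trans (cong (λ w → z + w) (×≡ n z)) (sym (ℤ.*-suc z (+ n)))
    additive : ∀ x y → ∃[ z ] (x + y) ^ p ≡ (x ^ p + y ^ p) + z * + p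
    additive x y =
      let z , eq = frobenius ℤ.+-*-commutativeSemiring p-prime x y
      in z , trans (sym (^≡ (x + y) p)) (trans eq
           (cong₂ _+_ (cong₂ _+_ (^≡ x p) (^≡ y p)) (×≡ p z)))
    nonneg : ∀ n → + p ∣ (+ n) ^ p - + n
    nonneg zero    = divides 0ℤ refl
    nonneg (suc n) =
      let z , eq = additive 1ℤ (+ n)
          1^p≡1 = cong (λ o → o + (+ n) ^ p + z * + p) (ℤ.^-zeroˡ p)
      in subst (+ p ∣_)
           (sym (trans (cong (λ w → w - + suc n) (trans eq 1^p≡1)) (rearrange ((+ n) ^ p) (+ n) (z * + p))))
           (∣m∣n⇒∣m+n (nonneg n) (divides z refl))
      where
      rearrange : ∀ y n w → ((1ℤ + y) + w) - (1ℤ + n) ≡ (y - n) + w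
      rearrange = solve-∀
    go : ∀ x → + p ∣ x ^ p - x
    go (+ n)    = nonneg n
    go -[1+ n ] =
      let x = + suc n
          z , eq = additive x (- x)
          zero-sum = trans (sym eq) (trans (cong (_^ p) (ℤ.+-inverseʳ x)) (ℤ.*-zeroˡ (0ℤ ^ p-1)))
      in subst (+ p ∣_)
           (sym (trans (rearrange x (x ^ p) ((- x) ^ p) (z * + p))
             (cong (λ s → s - z * + p - (x ^ p - x)) zero-sum)))
           (∣m∣n⇒∣m-n (∣m∣n⇒∣m-n (divides 0ℤ refl) (divides z refl)) (nonneg (suc n)))
      where
      rearrange : ∀ m x y w → y - - m ≡ ((x + y) + w) - w - (x - m)
      rearrange = solve-∀

  -- The quadratic ring of the roots and the law of apparition.

  -- ℤ[α] with α² = P α - Q; the pair (a , b) stands for a + b α.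
  module _ (P Q : ℤ) where

    ℤ[α] : CommutativeSemiring 0ℓ 0ℓ
    ℤ[α] = record
      { Carrier = ℤ × ℤ
      ; _≈_ = _≡_
      ; _+_ = _⊕_
      ; _*_ = _⊗_
      ; 0# = 0ℤ , 0ℤ
      ; 1# = 1ℤ , 0ℤ
      ; isCommutativeSemiring = isCommutativeSemiringˡ record
        { +-isCommutativeMonoid = isCommutativeMonoidˡ record
          { isSemigroup = record
            { isMagma = record { isEquivalence = isEquivalence ; ∙-cong = cong₂ _⊕_ }
            ; assoc = λ (a , b) (c , d) (e , f) → cong₂ _,_ (ℤ.+-assoc a c e) (ℤ.+-assoc b d f)
            }
          ; identityˡ = λ (a , b) → cong₂ _,_ (ℤ.+-identityˡ a) (ℤ.+-identityˡ b)
          ; comm = λ (a , b) (c , d) → cong₂ _,_ (ℤ.+-comm a c) (ℤ.+-comm b d)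
          }
        ; *-isCommutativeMonoid = isCommutativeMonoidˡ record
          { isSemigroup = record
            { isMagma = record { isEquivalence = isEquivalence ; ∙-cong = cong₂ _⊗_ }
            ; assoc = λ (a , b) (c , d) (e , f) → cong₂ _,_ (assoc₁ P Q a b c d e f) (assoc₂ P Q a b c d e f)
            }
          ; identityˡ = λ (a , b) → cong₂ _,_ (identity₁ Q a b) (identity₂ P a b)
          ; comm = λ (a , b) (c , d) → cong₂ _,_ (comm₁ Q a b c d) (comm₂ P a b c d)
          }
        ; distribʳ = λ (a , b) (c , d) (e , f) → cong₂ _,_ (distrib₁ Q a b c d e f) (distrib₂ P a b c d e f)
        ; zeroˡ = λ (a , b) → cong₂ _,_ (zero₁ Q a b) (zero₂ P a b)
        }
      }
      where
      _⊕_ _⊗_ : ℤ × ℤ → ℤ × ℤ → ℤ × ℤ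
      (a , b) ⊕ (c , d) = a + c , b + d
      (a , b) ⊗ (c , d) = a * c - Q * (b * d) , a * d + b * c + P * (b * d)
      assoc₁ : ∀ p q a b c d e f →
        (a * c - q * (b * d)) * e - q * ((a * d + b * c + p * (b * d)) * f) ≡
        a * (c * e - q * (d * f)) - q * (b * (c * f + d * e + p * (d * f)))
      assoc₁ = solve-∀
      assoc₂ : ∀ p q a b c d e f →
        (a * c - q * (b * d)) * f + (a * d + b * c + p * (b * d)) * e + p * ((a * d + b * c + p * (b * d)) * f) ≡
        a * (c * f + d * e + p * (d * f)) + b * (c * e - q * (d * f)) + p * (b * (c * f + d * e + p * (d * f)))
      assoc₂ = solve-∀
      identity₁ : ∀ q a b → 1ℤ * a - q * (0ℤ * b) ≡ a
      identity₁ = solve-∀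
      identity₂ : ∀ p a b → 1ℤ * b + 0ℤ * a + p * (0ℤ * b) ≡ b
      identity₂ = solve-∀
      comm₁ : ∀ q a b c d → a * c - q * (b * d) ≡ c * a - q * (d * b)
      comm₁ = solve-∀
      comm₂ : ∀ p a b c d → a * d + b * c + p * (b * d) ≡ c * b + d * a + p * (d * b)
      comm₂ = solve-∀
      distrib₁ : ∀ q a b c d e f → (c + e) * a - q * ((d + f) * b) ≡ (c * a - q * (d * b)) + (e * a - q * (f * b))
      distrib₁ = solve-∀
      distrib₂ : ∀ p a b c d e f → (c + e) * b + (d + f) * a + p * ((d + f) * b) ≡
        (c * b + d * a + p * (d * b)) + (e * b + f * a + p * (f * b))
      distrib₂ = solve-∀
      zero₁ : ∀ q a b → 0ℤ * a - q * (0ℤ * b) ≡ 0ℤ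
      zero₁ = solve-∀
      zero₂ : ∀ p a b → 0ℤ * b + 0ℤ * a + p * (0ℤ * b) ≡ 0ℤ
      zero₂ = solve-∀

    private
      module E = CommutativeSemiring ℤ[α]
      module Exp = Algebra.Properties.Semiring.Exp E.semiring
      module Mult = Algebra.Properties.CommutativeMonoid.Mult E.+-commutativeMonoid

    disc : ℤ
    disc = P * P - + 4 * Q

    -- α, its conjugate β = P - α, and δ = α - β with δ² = disc
    α β δ : E.Carrier
    α = 0ℤ , 1ℤ
    β = P , - 1ℤ
    δ = - P , + 2

    α^ : ∀ n → α Exp.^ suc n ≡ (- (Q * U P Q n) , U P Q (suc n))
    α^ zero    = cong₂ _,_ (base₁ Q) (base₂ P)
      where
      base₁ : ∀ q → 0ℤ * 1ℤ - q * (1ℤ * 0ℤ) ≡ - (q * 0ℤ)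
      base₁ = solve-∀
      base₂ : ∀ p → 0ℤ * 0ℤ + 1ℤ * 1ℤ + p * (1ℤ * 0ℤ) ≡ 1ℤ
      base₂ = solve-∀
    α^ (suc n) = trans (cong (α E.*_) (α^ n)) (cong₂ _,_ (step₁ Q x y) (step₂ P Q x y))
      where
      x = U P Q n
      y = U P Q (suc n)
      step₁ : ∀ q x y → 0ℤ * - (q * x) - q * (1ℤ * y) ≡ - (q * y)
      step₁ = solve-∀
      step₂ : ∀ p q x y → 0ℤ * y + 1ℤ * - (q * x) + p * (1ℤ * y) ≡ p * y - q * x
      step₂ = solve-∀

    -- Conjugating `α^` gives U (n+1) β - Q U n; substituting β = P - α turns the constant part into
    -- U (n+2).
    β^ : ∀ n → β Exp.^ suc n ≡ (U P Q (suc (suc n)) , - U P Q (suc n))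
    β^ zero    = cong₂ _,_ (base₁ P Q) (base₂ P)
      where
      base₁ : ∀ p q → p * 1ℤ - q * (- 1ℤ * 0ℤ) ≡ p * 1ℤ - q * 0ℤ
      base₁ = solve-∀
      base₂ : ∀ p → p * 0ℤ + - 1ℤ * 1ℤ + p * (- 1ℤ * 0ℤ) ≡ - 1ℤ
      base₂ = solve-∀
    β^ (suc n) = trans (cong (β E.*_) (β^ n)) (cong₂ _,_ (step₁ P Q x y) (step₂ P x y))
      where
      x = U P Q (suc n)
      y = U P Q (suc (suc n))
      step₁ : ∀ p q x y → p * y - q * (- 1ℤ * - x) ≡ p * y - q * x
      step₁ = solve-∀
      step₂ : ∀ p x y → p * - x + - 1ℤ * y + p * (- 1ℤ * - x) ≡ - y
      step₂ = solve-∀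

    δ^ : ∀ h → δ Exp.^ suc (h ℕ.* 2) ≡ (- P * disc ^ h , + 2 * disc ^ h)
    δ^ zero    = cong₂ _,_ (base₁ P Q) (base₂ P)
      where
      base₁ : ∀ p q → - p * 1ℤ - q * (+ 2 * 0ℤ) ≡ - p * 1ℤ
      base₁ = solve-∀
      base₂ : ∀ p → - p * 0ℤ + + 2 * 1ℤ + p * (+ 2 * 0ℤ) ≡ + 2 * 1ℤ
      base₂ = solve-∀
    δ^ (suc h) = trans (cong (λ x → δ E.* (δ E.* x)) (δ^ h))
      (cong₂ _,_ (step₁ P Q (disc ^ h)) (step₂ P Q (disc ^ h)))
      where
      step₁ : ∀ p q e →
        - p * (- p * (- p * e) - q * (+ 2 * (+ 2 * e)))
          - q * (+ 2 * (- p * (+ 2 * e) + + 2 * (- p * e) + p * (+ 2 * (+ 2 * e)))) ≡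
        - p * ((p * p - + 4 * q) * e)
      step₁ = solve-∀
      step₂ : ∀ p q e →
        - p * (- p * (+ 2 * e) + + 2 * (- p * e) + p * (+ 2 * (+ 2 * e)))
          + + 2 * (- p * (- p * e) - q * (+ 2 * (+ 2 * e)))
          + p * (+ 2 * (- p * (+ 2 * e) + + 2 * (- p * e) + p * (+ 2 * (+ 2 * e)))) ≡
        + 2 * ((p * p - + 4 * q) * e)
      step₂ = solve-∀

    proj₂-× : ∀ n z → proj₂ (n Mult.× z) ≡ proj₂ z * + n
    proj₂-× zero    z = sym (ℤ.*-zeroʳ (proj₂ z))
    proj₂-× (suc n) z = trans (cong (λ w → proj₂ z + w) (proj₂-× n z)) (sym (ℤ.*-suc (proj₂ z) (+ n)))

    -- Compare the coefficients of α in αˡ = (δ + β)ˡ ≡ δˡ + βˡ modulo ℓ.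
    ∣Uℓ-disc^h : ∀ {h} → let ℓ = suc (h ℕ.* 2) in Prime ℓ → + ℓ ∣ U P Q ℓ - disc ^ h
    -- The comparison reads U ℓ ≡ 2 discʰ - U ℓ, so ℓ divides twice the desired difference. The
    -- factor 2 is removed because ℓ is an odd prime; h = 0 would give ℓ = 1.
    ∣Uℓ-disc^h {h} ℓ-prime = [ (λ ℓ∣2 → contradiction (ℕ.∣⇒≤ (∣⇒∣ᵤ ℓ∣2)) (ℓ≰2 h ℓ-prime)) , id ]
      (euclidsLemmaℤ ℓ-prime (+ 2) (U P Q ℓ - disc ^ h) ℓ∣2*)
      where
      ℓ = suc (h ℕ.* 2)
      ℓ≰2 : ∀ h → Prime (suc (h ℕ.* 2)) → ¬ (suc (h ℕ.* 2) ℕ.≤ 2)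
      ℓ≰2 zero    p _ with () ← prime⇒nonTrivial p
      ℓ≰2 (suc h) _ (s≤s (s≤s ()))
      ℓ∣2* : + ℓ ∣ + 2 * (U P Q ℓ - disc ^ h)
      ℓ∣2* =
        let z , eq = frobenius ℤ[α] ℓ-prime δ β
            U≡ = begin
              U P Q ℓ
                ≡⟨ cong proj₂ (α^ (h ℕ.* 2)) ⟨
              proj₂ (α Exp.^ ℓ)
                ≡⟨ cong (λ x → proj₂ (x Exp.^ ℓ)) δ+β≡α ⟨
              proj₂ ((δ E.+ β) Exp.^ ℓ)
                ≡⟨ cong proj₂ eq ⟩
              proj₂ (δ Exp.^ ℓ) + proj₂ (β Exp.^ ℓ) + proj₂ (ℓ Mult.× z)
                ≡⟨ cong₂ _+_ (cong₂ _+_ (cong proj₂ (δ^ h)) (cong proj₂ (β^ (h ℕ.* 2)))) (proj₂-× ℓ z) ⟩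
              + 2 * disc ^ h + - U P Q ℓ + proj₂ z * + ℓ ∎
        in divides (proj₂ z) (isolate (U P Q ℓ) (disc ^ h) (proj₂ z * + ℓ) U≡)
        where
        open ≡-Reasoning
        δ+β≡α : δ E.+ β ≡ α
        δ+β≡α = cong₂ _,_ (ℤ.+-inverseˡ P) refl
        double : ∀ u e → + 2 * (u - e) ≡ u - (+ 2 * e + - u)
        double = solve-∀
        cancel : ∀ s w → s + w - s ≡ w
        cancel = solve-∀
        isolate : ∀ u e w → u ≡ + 2 * e + - u + w → + 2 * (u - e) ≡ w
        isolate u e w eq = trans (double u e)
          (trans (cong (λ v → v - (+ 2 * e + - u)) eq) (cancel (+ 2 * e + - u) w))

  fermat-unit : ∀ {p-1} → Prime (suc p-1) → ∀ x → ¬ (+ suc p-1 ∣ x) → + suc p-1 ∣ x ^ p-1 - 1ℤ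
  fermat-unit {p-1} p-prime x p∤x = [ (λ p∣x → contradiction p∣x p∤x) , id ]
    (euclidsLemmaℤ p-prime x (x ^ p-1 - 1ℤ)
      (subst (+ suc p-1 ∣_) (sym (factor x (x ^ p-1))) (fermat p-prime x)))
    where
    factor : ∀ x y → x * (y - 1ℤ) ≡ x * y - x
    factor = solve-∀

  -- Writing ℓ = 2h+1: if ℓ ∣ disc then U ℓ ≡ discʰ ≡ 0, and otherwise Cassini's
  -- identity gives U (ℓ-1) U (ℓ+1) = U ℓ ² - Q²ʰ ≡ disc²ʰ - Q²ʰ ≡ 0.
  law-of-apparition : ∀ P Q {h} → let ℓ = suc (suc h ℕ.* 2) in Prime ℓ → ¬ (+ ℓ ∣ Q) →
    (+ ℓ ∣ U P Q (suc h ℕ.* 2)) ⊎ (+ ℓ ∣ U P Q ℓ) ⊎ (+ ℓ ∣ U P Q (suc ℓ))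
  law-of-apparition P Q {h} ℓ-prime ℓ∤Q with + suc (suc h ℕ.* 2) ∣? disc P Q
  -- The exponent of the discriminant is `suc h`, hence positive, so the power vanishes modulo ℓ.
  ... | yes ℓ∣D = inj₂ (inj₁ (∣m-n∧∣n⇒∣m _ _ (∣Uℓ-disc^h P Q {suc h} ℓ-prime) (∣m⇒∣m*n (disc P Q ^ h) ℓ∣D)))
  ... | no  ℓ∤D = [ inj₁ , inj₂ ∘ inj₂ ] (euclidsLemmaℤ ℓ-prime w₀ w₁ (subst (+ ℓ ∣_) (sym w≡)
    (∣m∣n⇒∣m-n
      (∣m∣n⇒∣m+n (∣m⇒∣m*n (u + e) (∣Uℓ-disc^h P Q {suc h} ℓ-prime)) (fermat-unit ℓ-prime (disc P Q) ℓ∤D))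
      (fermat-unit ℓ-prime Q ℓ∤Q))))
    where
    2h = suc h ℕ.* 2
    ℓ  = suc 2h
    u  = U P Q ℓ
    w₀ = U P Q 2h
    w₁ = U P Q (suc ℓ)
    e  = disc P Q ^ suc h
    expand : ∀ u e w → w ≡ (u - e) * (u + e) + (e * e - 1ℤ) - (u * u - w - 1ℤ)
    expand = solve-∀
    e² : e * e ≡ disc P Q ^ 2h
    e² = trans (cong (e *_) (sym (ℤ.^-identityʳ e))) (ℤ.^-*-assoc (disc P Q) (suc h) 2)
    -- Each of the three summands is divisible by ℓ: the first since u ≡ e, the other two by Fermat
    -- with exponent ℓ - 1.
    w≡ : w₀ * w₁ ≡ (u - e) * (u + e) + (disc P Q ^ 2h - 1ℤ) - (Q ^ 2h - 1ℤ)
    w≡ = trans (expand u e (w₀ * w₁))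
      (cong₂ (λ x y → (u - e) * (u + e) + (x - 1ℤ) - (y - 1ℤ)) e² (cassini P Q 2h))

  -- Lucas terms of prime absolute value.

  2∤prime : ∀ {ℓ} → Prime ℓ → ℓ ≢ 2 → ¬ (2 ℕ.∣ ℓ)
  2∤prime ℓ-prime ℓ≢2 2∣ℓ with prime⇒irreducible ℓ-prime 2∣ℓ
  ... | inj₂ 2≡ℓ = ℓ≢2 (sym 2≡ℓ)

  -- This normal form serves odd indices, the odd prime ℓ and the odd weight `k` alike.
  odd⇒3+2t : ∀ n → ¬ (2 ℕ.∣ n) → 2 ℕ.≤ n → ∃[ t ] n ≡ 3 ℕ.+ t ℕ.* 2
  odd⇒3+2t 2 2∤2 _ = contradiction ℕ.∣-refl 2∤2
  odd⇒3+2t 3 _   _ = 0 , refl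
  odd⇒3+2t (suc (suc n@(suc (suc _)))) 2∤n+2 _ =
    let t , n≡3+2t = odd⇒3+2t n (2∤n+2 ∘ ℕ.∣m∣n⇒∣m+n ℕ.∣-refl) (s≤s (s≤s z≤n))
    in suc t , cong (2 ℕ.+_) n≡3+2t
  odd⇒3+2t 1 _ (s≤s ())

  -- With ℓ = k + 1 the number ℓ(ℓ² - 1) is the product of k, k + 1 and k + 2.
  ∣[1+k]*[[1+k]²∸1] : ∀ {d} k → d ℕ.∣ k ⊎ d ℕ.∣ suc k ⊎ d ℕ.∣ 2 ℕ.+ k →
    d ℕ.∣ suc k ℕ.* (suc k ℕ.^ 2 ℕ.∸ 1)
  ∣[1+k]*[[1+k]²∸1] {d} k = subst (λ n → d ℕ.∣ suc k ℕ.* n) (cong ℕ.pred (square k)) ∘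
    [ ℕ.∣n⇒∣m*n (suc k) ∘ ℕ.∣m⇒∣m*n (2 ℕ.+ k)
    , [ ℕ.∣m⇒∣m*n (k ℕ.* (2 ℕ.+ k)) , ℕ.∣n⇒∣m*n (suc k) ∘ ℕ.∣n⇒∣m*n k ]
    ]
    where
    square : ∀ k → suc (k ℕ.* (2 ℕ.+ k)) ≡ suc k ℕ.* (suc k ℕ.* 1)
    square = ℕ-Tactic.solve-∀

  2≤m^[1+n] : ∀ {m} → 2 ℕ.≤ m → ∀ n → 2 ℕ.≤ m ℕ.^ suc n
  2≤m^[1+n] {m} 2≤m n = ℕ.≤-trans 2≤m
    (ℕ.m≤m*n m (m ℕ.^ n) ⦃ ℕ.m^n≢0 m n ⦃ ℕ.>-nonZero (ℕ.≤-trans (s≤s z≤n) 2≤m) ⦄ ⦄)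

  ∣U-odd-index∣≢1 : ∀ P Q {b} n → ∣ Q ∣ ≡ b ℕ.* b → 2 ℕ.≤ b → ¬ (2 ℕ.∣ n) → 2 ℕ.≤ n → ∣ U P Q n ∣ ≢ 1
  ∣U-odd-index∣≢1 P Q n ∣Q∣≡b² 2≤b 2∤n 2≤n =
    let t , n≡3+2t = odd⇒3+2t n 2∤n 2≤n
    in subst (λ n → ∣ U P Q n ∣ ≢ 1) (sym n≡3+2t) (∣U-odd∣≢1 P Q ∣Q∣≡b² 2≤b t)

  module _ (P Q : ℤ) {b : ℕ} (∣Q∣≡b² : ∣ Q ∣ ≡ b ℕ.* b) (2≤b : 2 ℕ.≤ b) where

    -- Keeps the hypothesis on `Q` valid for the sequence with parameters `V r` and `Q ^ r`.
    ∣Q^∣≡[b^]² : ∀ r → ∣ Q ^ r ∣ ≡ b ℕ.^ r ℕ.* b ℕ.^ r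
    ∣Q^∣≡[b^]² zero    = refl
    ∣Q^∣≡[b^]² (suc r) = begin
      ∣ Q * Q ^ r ∣                          ≡⟨ ℤ.abs-* Q (Q ^ r) ⟩
      ∣ Q ∣ ℕ.* ∣ Q ^ r ∣                    ≡⟨ cong₂ ℕ._*_ ∣Q∣≡b² (∣Q^∣≡[b^]² r) ⟩
      b ℕ.* b ℕ.* (b ℕ.^ r ℕ.* b ℕ.^ r)      ≡⟨ ℕ.[m*n]*[o*p]≡[m*o]*[n*p] b b (b ℕ.^ r) (b ℕ.^ r) ⟩
      b ℕ.* b ℕ.^ r ℕ.* (b ℕ.* b ℕ.^ r)      ∎
      where open ≡-Reasoning

    -- If ℓ ∣ Q = ±b² then ℓ ∣ b, so ℓ² ∣ Q; also ℓ ∣ P. Then ℓ² divides the term, whose absolute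
    -- value is ℓ.
    ∣U∣prime⇒∤Q : ∀ {ℓ} n → Prime ℓ → ∣ U P Q (3 ℕ.+ n) ∣ ≡ ℓ → ¬ (+ ℓ ∣ Q)
    ∣U∣prime⇒∤Q {ℓ} n ℓ-prime ∣U∣≡ℓ ℓ∣Q = ℕ.<⇒≱ ℓ<ℓ² (ℕ.∣⇒≤ ⦃ prime⇒nonZero ℓ-prime ⦄ ℓ²∣ℓ)
      where
      ℓ∣b : ℓ ℕ.∣ b
      ℓ∣b = [ id , id ] (euclidsLemma b b ℓ-prime (subst (ℓ ℕ.∣_) ∣Q∣≡b² (∣⇒∣ᵤ ℓ∣Q)))
      ℓ²∣Q : + ℓ * + ℓ ∣ Q
      ℓ²∣Q = ∣ᵤ⇒∣ (subst₂ ℕ._∣_ (sym (ℤ.abs-* (+ ℓ) (+ ℓ))) (sym ∣Q∣≡b²) (ℕ.*-pres-∣ ℓ∣b ℓ∣b))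
      ℓ∣P : + ℓ ∣ P
      ℓ∣P = ∣Q∧∣U⇒∣P P Q ℓ-prime ℓ∣Q (2 ℕ.+ n) (∣ᵤ⇒∣ (ℕ.∣-reflexive (sym ∣U∣≡ℓ)))
      ℓ²∣ℓ : ℓ ℕ.* ℓ ℕ.∣ ℓ
      ℓ²∣ℓ = subst₂ ℕ._∣_ (ℤ.abs-* (+ ℓ) (+ ℓ)) ∣U∣≡ℓ (∣⇒∣ᵤ (∣P∧∣Q⇒i²∣U P Q ℓ∣P ℓ²∣Q n))
      ℓ<ℓ² : ℓ ℕ.< ℓ ℕ.* ℓ
      ℓ<ℓ² = ℕ.m<m*n ℓ ℓ ⦃ prime⇒nonZero ℓ-prime ⦄ (ℕ.nonTrivial⇒n>1 ℓ ⦃ prime⇒nonTrivial ℓ-prime ⦄)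

    -- For d = q r with 1 < r < d both factors in U d = U r · U_q(V r, Qʳ) have
    -- absolute value ≠ 1.
    ∣U∣prime⇒prime-index : ∀ {ℓ d} → Prime ℓ → ¬ (2 ℕ.∣ d) → 2 ℕ.≤ d → ∣ U P Q d ∣ ≡ ℓ → Prime d
    ∣U∣prime⇒prime-index {ℓ} {d} ℓ-prime 2∤d 2≤d ∣U∣≡ℓ =
      prime ⦃ ℕ.n>1⇒nonTrivial 2≤d ⦄ λ
        { (ℕ.hasNonTrivialDivisor {divisor = r} ⦃ r>1 ⦄ r<d (ℕ.divides q d≡qr)) →
            ¬factor q r (ℕ.nonTrivial⇒n>1 r ⦃ r>1 ⦄) r<d d≡qr }
      where
      instance _ = prime⇒nonZero ℓ-prime
      ¬factor : ∀ q r → 1 ℕ.< r → r ℕ.< d → d ≢ q ℕ.* r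
      ¬factor zero       r 1<r r<d refl = ℕ.n≮0 r<d
      ¬factor (suc zero) r 1<r r<d refl = ℕ.<-irrefl (sym (ℕ.+-identityʳ r)) r<d
      ¬factor q@(suc (suc _)) r@(suc r-1) 1<r r<d refl =
        -- Since x y = ℓ is prime, either x = 1 or x = ℓ and y = 1; `r` and `q` are odd and at least
        -- 2, so both are impossible.
        [ ∣U-odd-index∣≢1 P Q r ∣Q∣≡b² 2≤b (λ 2∣r → 2∤d (ℕ.∣n⇒∣m*n q 2∣r)) 1<r
        , (λ x≡ℓ → ∣U-odd-index∣≢1 (V P Q r) (Q ^ r) q (∣Q^∣≡[b^]² r) (2≤m^[1+n] 2≤b r-1)
            (λ 2∣q → 2∤d (ℕ.∣m⇒∣m*n r 2∣q)) (s≤s (s≤s z≤n)) (y≡1 x≡ℓ))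
        ] (prime⇒irreducible ℓ-prime (ℕ.divides y (trans (sym xy≡ℓ) (ℕ.*-comm x y))))
        where
        x = ∣ U P Q r ∣
        y = ∣ U (V P Q r) (Q ^ r) q ∣
        xy≡ℓ : x ℕ.* y ≡ ℓ
        xy≡ℓ = begin
          x ℕ.* y                                    ≡⟨ ℤ.abs-* (U P Q r) (U (V P Q r) (Q ^ r) q) ⟨
          ∣ U P Q r * U (V P Q r) (Q ^ r) q ∣        ≡⟨ cong ∣_∣ (U-* P Q r q) ⟨
          ∣ U P Q (q ℕ.* r) ∣                        ≡⟨ ∣U∣≡ℓ ⟩
          ℓ                                          ∎
          where open ≡-Reasoning
        y≡1 : x ≡ ℓ → y ≡ 1
        y≡1 x≡ℓ = ℕ.*-cancelˡ-≡ y 1 ℓ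
          (trans (cong (ℕ._* y) (sym x≡ℓ)) (trans xy≡ℓ (sym (ℕ.*-identityʳ ℓ))))

    -- Apparition puts ℓ into a term of index ℓ - 1, ℓ or ℓ + 1. As `d` is prime, ℓ ∣ U d and ℓ ∤ Q,
    -- the index `d` divides one of these three.
    ∣U∣prime⇒index∣ : ∀ {ℓ d} → Prime ℓ → ℓ ≢ 2 → ¬ (2 ℕ.∣ d) → 2 ℕ.≤ d → ∣ U P Q d ∣ ≡ ℓ →
      d ℕ.∣ ℓ ℕ.* (ℓ ℕ.^ 2 ℕ.∸ 1)
    ∣U∣prime⇒index∣ {ℓ} {d} ℓ-prime ℓ≢2 2∤d 2≤d ∣U∣≡ℓ =
      go (odd⇒3+2t ℓ (2∤prime ℓ-prime ℓ≢2) (ℕ.nonTrivial⇒n>1 ℓ ⦃ prime⇒nonTrivial ℓ-prime ⦄))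
      where
      ℓ∤Q : ¬ (+ ℓ ∣ Q)
      ℓ∤Q = let t , d≡3+2t = odd⇒3+2t d 2∤d 2≤d in
        ∣U∣prime⇒∤Q (t ℕ.* 2) ℓ-prime (trans (cong (λ n → ∣ U P Q n ∣) (sym d≡3+2t)) ∣U∣≡ℓ)
      d∣ : ∀ {m} → + ℓ ∣ U P Q m → d ℕ.∣ m
      d∣ = ∣U⇒∣index P Q ℓ-prime ℓ∤Q (∣U∣prime⇒prime-index ℓ-prime 2∤d 2≤d ∣U∣≡ℓ)
        (∣ᵤ⇒∣ (ℕ.∣-reflexive (sym ∣U∣≡ℓ)))
      go : ∃[ t ] ℓ ≡ 3 ℕ.+ t ℕ.* 2 → d ℕ.∣ ℓ ℕ.* (ℓ ℕ.^ 2 ℕ.∸ 1)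
      go (t , ℓ≡3+2t) = subst (λ n → d ℕ.∣ n ℕ.* (n ℕ.^ 2 ℕ.∸ 1)) (sym ℓ≡3+2t)
        (∣[1+k]*[[1+k]²∸1] k (Sum.map (d∣ {k}) (Sum.map (d∣ {suc k}) (d∣ {2 ℕ.+ k})) divisible))
        where
        k = suc t ℕ.* 2
        divisible : (+ ℓ ∣ U P Q k) ⊎ (+ ℓ ∣ U P Q (suc k)) ⊎ (+ ℓ ∣ U P Q (2 ℕ.+ k))
        divisible = subst (λ ℓ → Prime ℓ → ¬ (+ ℓ ∣ Q) →
          (+ ℓ ∣ U P Q k) ⊎ (+ ℓ ∣ U P Q (suc k)) ⊎ (+ ℓ ∣ U P Q (2 ℕ.+ k)))
          (sym ℓ≡3+2t) (law-of-apparition P Q {t}) ℓ-prime ℓ∤Q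

-- Hecke relations for the integer coefficients.

module Coefficients where

  open import Defs
    using (_+i_; _≈_; 0ᶜ; 1ᶜ; close; eval; fromℤ-*; fromℤ-sub; hecke; module C; natᶜ; pointwise; sum-syntax)
  import Defs as ℂ using (_+_; _*_; _-_; -_; _^_)
  import Algebra.Properties.Monoid.Sum
  open import Data.Bool.Base using (if_then_else_)
  open import Data.Integer.Base as ℤ using (ℤ; +_; -[1+_]; 0ℤ; 1ℤ; ∣_∣)
  open import Data.Nat.Divisibility using (_∣_; _∣?_)
  import Data.Nat.DivMod as ℕ
  open import Data.Rational.Base as ℚ using (0ℚ; 1ℚ)
  open import Data.Rational.Literals using (fromℤ)
  import Data.Rational.Properties as ℚ
  open import Data.Rational.Solver using (module +-*-Solver)
  open import Relation.Nullary.Decidable using (dec-true; dec-false)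

  private
    module CSum = Algebra.Properties.Monoid.Sum C.+-monoid

  -- Integers are constant Cauchy sequences, so tolerance 1 already gives |i - j| < 1. This brings
  -- relations proved in ℂ back to ℤ.
  intᶜ-injective : ∀ {i j} → intᶜ i ≈ intᶜ j → i ≡ j
  intᶜ-injective {i} {j} (i≈j +i _) =
    let M , i-j<1 = close i≈j 1ℚ (ℚ.positive⁻¹ 1ℚ)
    in ℤ.i-j≡0⇒i≡j i j (∣·∣<1⇒≡0 (i ℤ.- j)
         (subst (λ q → ℚ.∣ q ∣ ℚ.< 1ℚ) (sym (fromℤ-sub i j)) (i-j<1 M ℕ.≤-refl)))
    where
    ∣·∣<1⇒≡0 : ∀ k → ℚ.∣ fromℤ k ∣ ℚ.< 1ℚ → k ≡ 0ℤ
    ∣·∣<1⇒≡0 (+ zero)    _ = refl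
    ∣·∣<1⇒≡0 (+ suc n)   (ℚ.*<* (ℤ.+<+ (s≤s ())))
    ∣·∣<1⇒≡0 (-[1+ n ])  (ℚ.*<* (ℤ.+<+ (s≤s ())))

  intᶜ-* : ∀ i j → intᶜ (i ℤ.* j) ≈ intᶜ i ℂ.* intᶜ j
  intᶜ-* i j =
    (pointwise λ _ → trans (fromℤ-* i j)
      (solve 2 (λ x y → x :* y := x :* y :- con 0ℚ :* con 0ℚ) refl (fromℤ i) (fromℤ j)))
    +i (pointwise λ _ → solve 2 (λ x y → con 0ℚ := x :* con 0ℚ :+ con 0ℚ :* y) refl (fromℤ i) (fromℤ j))
    where open +-*-Solver

  intᶜ-sub : ∀ i j → intᶜ (i ℤ.- j) ≈ intᶜ i ℂ.- intᶜ j
  intᶜ-sub i j = (pointwise λ _ → fromℤ-sub i j) +i (pointwise λ _ → refl)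

  intᶜ-^ : ∀ i n → intᶜ (i ℤ.^ n) ≈ intᶜ i ℂ.^ n
  intᶜ-^ i zero    = C.refl
  intᶜ-^ i (suc n) = C.trans (intᶜ-* i (i ℤ.^ n)) (C.*-congˡ (intᶜ-^ i n))

  m*[m*n]/[m*m]≡n : ∀ m n .⦃ _ : ℕ.NonZero (m ℕ.* m) ⦄ → (m ℕ.* (m ℕ.* n)) ℕ./ (m ℕ.* m) ≡ n
  m*[m*n]/[m*m]≡n m n = begin
    (m ℕ.* (m ℕ.* n)) ℕ./ (m ℕ.* m)    ≡⟨ ℕ./-congˡ {o = m ℕ.* m} (ℕ.*-assoc m m n) ⟨
    (m ℕ.* m ℕ.* n) ℕ./ (m ℕ.* m)      ≡⟨ ℕ./-congˡ {o = m ℕ.* m} (ℕ.*-comm (m ℕ.* m) n) ⟩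
    (n ℕ.* (m ℕ.* m)) ℕ./ (m ℕ.* m)    ≡⟨ ℕ.m*n/n≡m n (m ℕ.* m) ⟩
    n                                  ∎
    where open ≡-Reasoning

  quadratic-value : ∀ {N} (χ : DirichletCharacter N) → IsQuadratic χ → ∀ m →
    ∃[ ε ] eval χ m ≈ intᶜ ε × (ε ≡ 0ℤ ⊎ ∣ ε ∣ ≡ 1)
  quadratic-value χ (values , _) m with values m
  ... | inj₁ χm≈0         = 0ℤ , χm≈0 , inj₁ refl
  ... | inj₂ (inj₁ χm≈1)  = 1ℤ , χm≈1 , inj₂ refl
  ... | inj₂ (inj₂ χm≈-1) = ℤ.-1ℤ , C.trans χm≈-1 ((pointwise λ _ → refl) +i (pointwise λ _ → refl)) , inj₂ refl

  module _ (k : ℕ) {N : ℕ} (χ : DirichletCharacter N) (c : ℕ → ℂ) where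

    open SetoidReasoning C.setoid

    heckeSummand : ℕ → ℕ → ℂ
    heckeSummand q d-1 = eval χ (+ suc d-1) ℂ.* natᶜ (suc d-1) ℂ.^ (k ∸ 1) ℂ.* c (q ℕ./ (suc d-1 ℕ.* suc d-1))

    heckeTerm : ℕ → ℕ → ℕ → ℂ
    heckeTerm g q d-1 = if does (suc d-1 ∣? g) then heckeSummand q d-1 else 0ᶜ

    -- The gcd occurs both as the length of the sum and in its divisibility test; the parameter `g`
    -- replaces both at once.
    hecke≡ : ∀ m n {g} → gcd m n ≡ g → hecke k χ m c n ≡ ∑[ j < g ] heckeTerm g (m ℕ.* n) (toℕ j)
    hecke≡ m n refl = refl

    heckeTerm-∣ : ∀ g q {d-1} → suc d-1 ∣ g → heckeTerm g q d-1 ≡ heckeSummand q d-1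
    heckeTerm-∣ g q {d-1} d∣g = cong (λ b → if b then heckeSummand q d-1 else 0ᶜ) (dec-true (suc d-1 ∣? g) d∣g)

    heckeTerm-∤ : ∀ g q {d-1} → ¬ (suc d-1 ∣ g) → heckeTerm g q d-1 ≡ 0ᶜ
    heckeTerm-∤ g q {d-1} d∤g = cong (λ b → if b then heckeSummand q d-1 else 0ᶜ) (dec-false (suc d-1 ∣? g) d∤g)

    1^n≈1 : ∀ n → natᶜ 1 ℂ.^ n ≈ 1ᶜ
    1^n≈1 zero    = C.refl
    1^n≈1 (suc n) = C.trans (C.*-identityˡ (natᶜ 1 ℂ.^ n)) (1^n≈1 n)

    heckeSummand-1 : ∀ q → heckeSummand q 0 ≈ c q
    heckeSummand-1 q = begin
      eval χ 1ℤ ℂ.* natᶜ 1 ℂ.^ (k ∸ 1) ℂ.* c (q ℕ./ 1)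
        ≈⟨ C.*-congʳ (C.*-cong (DirichletCharacter.at-1 χ) (1^n≈1 (k ∸ 1))) ⟩
      1ᶜ ℂ.* 1ᶜ ℂ.* c (q ℕ./ 1)     ≈⟨ C.*-congʳ (C.*-identityˡ 1ᶜ) ⟩
      1ᶜ ℂ.* c (q ℕ./ 1)            ≈⟨ C.*-identityˡ (c (q ℕ./ 1)) ⟩
      c (q ℕ./ 1)                   ≡⟨ cong c (ℕ.n/1≡n q) ⟩
      c q                           ∎

    hecke-coprime : ∀ m n → gcd m n ≡ 1 → hecke k χ m c n ≈ c (m ℕ.* n)
    hecke-coprime m n gcd≡1 = begin
      hecke k χ m c n                        ≡⟨ hecke≡ m n gcd≡1 ⟩
      heckeTerm 1 (m ℕ.* n) 0 ℂ.+ 0ᶜ         ≈⟨ C.+-identityʳ _ ⟩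
      heckeTerm 1 (m ℕ.* n) 0                ≡⟨ heckeTerm-∣ 1 (m ℕ.* n) ℕ.∣-refl ⟩
      heckeSummand (m ℕ.* n) 0               ≈⟨ heckeSummand-1 (m ℕ.* n) ⟩
      c (m ℕ.* n)                            ∎

    -- Only the divisors 1 and `p` contribute: they are the first and last terms, and the middle of
    -- the sum vanishes.
    hecke-prime : ∀ {p-1} → let p = suc p-1 in Prime p → ∀ n → gcd p n ≡ p →
      hecke k χ p c n ≈ c (p ℕ.* n) ℂ.+ heckeSummand (p ℕ.* n) p-1
    hecke-prime {zero} p-prime = contradiction p-prime ¬prime[1]
    hecke-prime {p-1@(suc p-2)} p-prime n gcd≡p = begin
      hecke k χ p c n
        ≡⟨ hecke≡ p n gcd≡p ⟩
      t 0 ℂ.+ CSum.sum (t ∘ suc ∘ toℕ {p-1})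
        ≈⟨ C.+-congˡ (CSum.sum-init-last {p-2} (t ∘ suc ∘ toℕ)) ⟩
      t 0 ℂ.+ (CSum.sum {p-2} (t ∘ suc ∘ toℕ ∘ inject₁) ℂ.+ t (suc (toℕ (fromℕ p-2))))
        ≈⟨ C.+-cong first (C.+-cong middle (C.reflexive final)) ⟩
      c (p ℕ.* n) ℂ.+ (0ᶜ ℂ.+ heckeSummand (p ℕ.* n) p-1)
        ≈⟨ C.+-congˡ (C.+-identityˡ _) ⟩
      c (p ℕ.* n) ℂ.+ heckeSummand (p ℕ.* n) p-1 ∎
      where
      p = suc p-1
      t : ℕ → ℂ
      t = heckeTerm p (p ℕ.* n)
      first : t 0 ≈ c (p ℕ.* n)
      first = C.trans (C.reflexive (heckeTerm-∣ p (p ℕ.* n) (ℕ.1∣ p))) (heckeSummand-1 (p ℕ.* n))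
      final : t (suc (toℕ (fromℕ p-2))) ≡ heckeSummand (p ℕ.* n) p-1
      final = trans (cong (t ∘ suc) (toℕ-fromℕ p-2)) (heckeTerm-∣ p (p ℕ.* n) ℕ.∣-refl)
      no-divisor : ∀ (i : Fin p-2) → ¬ (2 ℕ.+ toℕ (inject₁ i) ∣ p)
      no-divisor i d∣p with prime⇒irreducible p-prime d∣p
      ... | inj₂ d≡p = ℕ.<⇒≢ (toℕ<n i)
        (trans (sym (toℕ-inject₁ i)) (ℕ.suc-injective (ℕ.suc-injective d≡p)))
      middle : CSum.sum {p-2} (t ∘ suc ∘ toℕ ∘ inject₁) ≈ 0ᶜ
      middle = C.trans (C.reflexive (CSum.sum-cong-≗ (λ i → heckeTerm-∤ p (p ℕ.* n) (no-divisor i))))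
        (CSum.sum-replicate-zero p-2)

    module _ {f : ℍ → ℂ} (newform : IsNewform k N χ f c) where
      open IsNewform newform

      -- Comparing the coefficients of q identifies the eigenvalue: μ = μ c(1), which is the first
      -- coefficient of T_m f, namely c(m).
      hecke-eigenvalue : ∀ m n → 1 ℕ.≤ m → hecke k χ m c n ≈ c m ℂ.* c n
      hecke-eigenvalue m n 1≤m =
        let μ , T[m]c≈μc = eigenform m 1≤m
        in C.trans (T[m]c≈μc n) (C.*-congʳ (begin
          μ                  ≈⟨ C.*-identityʳ μ ⟨
          μ ℂ.* 1ᶜ           ≈⟨ C.*-congˡ normalized ⟨
          μ ℂ.* c 1          ≈⟨ T[m]c≈μc 1 ⟨
          hecke k χ m c 1    ≈⟨ hecke-coprime m 1 (ℕ.∣1⇒≡1 (gcd[m,n]∣n m 1)) ⟩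
          c (m ℕ.* 1)        ≡⟨ cong c (ℕ.*-identityʳ m) ⟩
          c m                ∎))
  
  module _ {k N : ℕ} {χ : DirichletCharacter N} {f : ℍ → ℂ} {a : ℕ → ℤ}
    (newform : IsNewform k N χ f (intᶜ ∘ a)) where

    open SetoidReasoning C.setoid

    a[1]≡1 : a 1 ≡ 1ℤ
    a[1]≡1 = intᶜ-injective (IsNewform.normalized newform)

    a-multiplicative : ∀ m n → 1 ℕ.≤ m → gcd m n ≡ 1 → a (m ℕ.* n) ≡ a m ℤ.* a n
    a-multiplicative m n 1≤m gcd≡1 = intᶜ-injective (begin
      intᶜ (a (m ℕ.* n))                ≈⟨ hecke-coprime k χ (intᶜ ∘ a) m n gcd≡1 ⟨
      hecke k χ m (intᶜ ∘ a) n          ≈⟨ hecke-eigenvalue k χ (intᶜ ∘ a) newform m n 1≤m ⟩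
      intᶜ (a m) ℂ.* intᶜ (a n)         ≈⟨ intᶜ-* (a m) (a n) ⟨
      intᶜ (a m ℤ.* a n)                ∎)

    -- The coefficient of T_p at index pʳ⁺¹; its second term has index p · pʳ⁺¹ / p² = pʳ.
    a-recurrence : ∀ {p ε} → Prime p → eval χ (+ p) ≈ intᶜ ε → ∀ r →
      a (p ℕ.^ suc (suc r)) ≡ a p ℤ.* a (p ℕ.^ suc r) ℤ.- ε ℤ.* (+ p) ℤ.^ (k ∸ 1) ℤ.* a (p ℕ.^ r)
    a-recurrence {zero}    p-prime = contradiction p-prime ¬prime[0]
    a-recurrence {p@(suc p-1)} {ε} p-prime χp≈ε r = intᶜ-injective (begin
      intᶜ (a (p ℕ.* n))
        ≈⟨ +≈⇒≈- _ _ _ (C.trans (C.sym (hecke-prime k χ (intᶜ ∘ a) p-prime n gcd≡p))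
             (hecke-eigenvalue k χ (intᶜ ∘ a) newform p n (s≤s z≤n))) ⟩
      intᶜ (a p) ℂ.* intᶜ (a n) ℂ.- heckeSummand k χ (intᶜ ∘ a) (p ℕ.* n) p-1
        ≈⟨ C.+-cong (intᶜ-* (a p) (a n)) (C.-‿cong summand) ⟨
      intᶜ (a p ℤ.* a n) ℂ.- intᶜ (ε ℤ.* (+ p) ℤ.^ (k ∸ 1) ℤ.* a (p ℕ.^ r))
        ≈⟨ intᶜ-sub (a p ℤ.* a n) _ ⟨
      intᶜ (a p ℤ.* a n ℤ.- ε ℤ.* (+ p) ℤ.^ (k ∸ 1) ℤ.* a (p ℕ.^ r)) ∎)
      where
      n = p ℕ.^ suc r
      gcd≡p : gcd p n ≡ p
      gcd≡p = ℕ.∣-antisym (gcd[m,n]∣m p n) (gcd-greatest ℕ.∣-refl (ℕ.m∣m*n (p ℕ.^ r)))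
      +≈⇒≈- : ∀ x y z → x ℂ.+ y ≈ z → x ≈ z ℂ.- y
      +≈⇒≈- x y z x+y≈z = begin
        x                          ≈⟨ C.+-identityʳ x ⟨
        x ℂ.+ 0ᶜ                   ≈⟨ C.+-congˡ (C.-‿inverseʳ y) ⟨
        x ℂ.+ (y ℂ.- y)            ≈⟨ C.+-assoc x y (ℂ.- y) ⟨
        (x ℂ.+ y) ℂ.- y            ≈⟨ C.+-congʳ x+y≈z ⟩
        z ℂ.- y                    ∎
      summand : intᶜ (ε ℤ.* (+ p) ℤ.^ (k ∸ 1) ℤ.* a (p ℕ.^ r)) ≈ heckeSummand k χ (intᶜ ∘ a) (p ℕ.* n) p-1
      summand = begin
        intᶜ (ε ℤ.* (+ p) ℤ.^ (k ∸ 1) ℤ.* a (p ℕ.^ r))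
          ≈⟨ intᶜ-* (ε ℤ.* (+ p) ℤ.^ (k ∸ 1)) (a (p ℕ.^ r)) ⟩
        intᶜ (ε ℤ.* (+ p) ℤ.^ (k ∸ 1)) ℂ.* intᶜ (a (p ℕ.^ r))
          ≈⟨ C.*-congʳ (intᶜ-* ε ((+ p) ℤ.^ (k ∸ 1))) ⟩
        intᶜ ε ℂ.* intᶜ ((+ p) ℤ.^ (k ∸ 1)) ℂ.* intᶜ (a (p ℕ.^ r))
          ≈⟨ C.*-cong (C.*-cong (C.sym χp≈ε) (intᶜ-^ (+ p) (k ∸ 1)))
                      (C.reflexive (cong (intᶜ ∘ a) (sym (m*[m*n]/[m*m]≡n p (p ℕ.^ r))))) ⟩
        heckeSummand k χ (intᶜ ∘ a) (p ℕ.* n) p-1 ∎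

open LucasSequences
  using (U; U-even; ∣P∧∣Q⇒∣U; odd⇒3+2t; 2∤prime; 2≤m^[1+n]; ∣U-odd-index∣≢1;
         ∣U∣prime⇒prime-index; ∣U∣prime⇒index∣)
open Coefficients using (a[1]≡1; a-multiplicative; a-recurrence; quadratic-value)
open import Defs using (_≈_; eval)
open import Data.Integer.Base as ℤ using (ℤ; ∣_∣; +_; 0ℤ; 1ℤ)
import Data.Integer.Divisibility.Signed as ℤ
open import Data.List.Base using ([]; _∷_)
open import Data.List.Relation.Unary.All using (_∷_)
open import Data.Nat.Base using (_*_; _^_; _≤_; _<_; >-nonZero; nonTrivial⇒n>1)
open import Data.Nat.Divisibility
  using (_∣_; _∣?_; _∣0; divides; ∣1⇒≡1; ∣-trans; m∣m*n; ∣n⇒∣m*n)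
open import Data.Nat.Induction using (<-rec)
open import Data.Nat.ListAction using (product)
open import Data.Nat.Primality.Factorisation using (PrimeFactorisation; factorise)

-- Splitting off a prime power.

prime-divisor : ∀ {n} → 1 < n → ∃[ p ] Prime p × p ∣ n
prime-divisor {n} 1<n = go (factorise n ⦃ >-nonZero (ℕ.<-trans (s≤s z≤n) 1<n) ⦄)
  where
  go : PrimeFactorisation n → ∃[ p ] Prime p × p ∣ n
  go record { factors = [] ; isFactorisation = n≡1 } = contradiction (sym n≡1) (ℕ.<⇒≢ 1<n)
  go record { factors = p ∷ ps ; isFactorisation = n≡p*ps ; factorsPrime = p-prime ∷ _ } =
    p , p-prime , subst (p ∣_) (sym n≡p*ps) (m∣m*n (product ps))

prime∤⇒coprime-^ : ∀ {p m} → Prime p → ¬ (p ∣ m) → ∀ e → Coprime (p ^ e) m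
prime∤⇒coprime-^ p-prime p∤m zero    (d∣1 , _)   = ∣1⇒≡1 d∣1
prime∤⇒coprime-^ {p} {m} p-prime p∤m (suc e) {d} (d∣p^ , d∣m) =
  prime∤⇒coprime-^ p-prime p∤m e (coprime-divisor d⊥p d∣p^ , d∣m)
  where
  d⊥p : Coprime d p
  d⊥p (c∣d , c∣p) =
    [ id , (λ { refl → contradiction (∣-trans c∣d d∣m) p∤m }) ] (prime⇒irreducible p-prime c∣p)

split-prime-power : ∀ {p} → Prime p → ∀ n → 1 ≤ n → ∃₂ λ e m → n ≡ p ^ e * m × ¬ (p ∣ m)
split-prime-power {p} p-prime = <-rec _ step
  where
  step : ∀ n → (∀ {m} → m < n → 1 ≤ m → ∃₂ λ e m′ → m ≡ p ^ e * m′ × ¬ (p ∣ m′)) →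
    1 ≤ n → ∃₂ λ e m → n ≡ p ^ e * m × ¬ (p ∣ m)
  step n rec 1≤n with p ∣? n
  ... | no p∤n = 0 , n , sym (ℕ.*-identityˡ n) , p∤n
  ... | yes (divides zero n≡0) = contradiction (sym n≡0) (ℕ.<⇒≢ 1≤n)
  ... | yes (divides n′@(suc _) refl) =
    let e , m , n′≡p^e*m , p∤m =
          rec (ℕ.m<m*n n′ p (nonTrivial⇒n>1 p ⦃ prime⇒nonTrivial p-prime ⦄)) (s≤s z≤n)
    in suc e , m ,
       trans (cong (_* p) n′≡p^e*m) (trans (ℕ.*-comm (p ^ e * m) p) (sym (ℕ.*-assoc p (p ^ e) m))) ,
       p∤m

-- Coefficients as Lucas terms and the reduction to prime powers.

module _ {k N : ℕ} {χ : DirichletCharacter N} {f : ℍ → ℂ} {a : ℕ → ℤ}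
  (newform : IsNewform k N χ f (λ n → intᶜ (a n))) where

  -- Both sides satisfy the same recurrence; the index shift comes from a(1) = 1 = U 1.
  a[p^r]≡U : ∀ {p ε} → Prime p → eval χ (+ p) ≈ intᶜ ε → ∀ r →
    a (p ^ r) ≡ U (a p) (ε ℤ.* (+ p) ℤ.^ (k ∸ 1)) (suc r)
  a[p^r]≡U p-prime χp≈ε zero = a[1]≡1 newform
  a[p^r]≡U {p} {ε} p-prime χp≈ε (suc zero) =
    trans (cong a (ℕ.*-identityʳ p)) (U₂ (a p) (ε ℤ.* (+ p) ℤ.^ (k ∸ 1)))
    where
    U₂ : ∀ P Q → P ≡ P ℤ.* 1ℤ ℤ.- Q ℤ.* 0ℤ
    U₂ = solve-∀
  a[p^r]≡U {p} {ε} p-prime χp≈ε (suc (suc r)) = trans (a-recurrence newform p-prime χp≈ε r)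
    (cong₂ (λ x y → a p ℤ.* x ℤ.- ε ℤ.* (+ p) ℤ.^ (k ∸ 1) ℤ.* y)
      (a[p^r]≡U p-prime χp≈ε (suc r)) (a[p^r]≡U p-prime χp≈ε r))

  module _ (3≤k : 3 ≤ k) (2∤k : ¬ (2 ∣ k)) (χ-quadratic : IsQuadratic χ)
    (even : TrivialResidualMod2 N a) where

    -- If χ(p) = 0 the recurrence makes all a(pʳ) with r ≥ 1 even.
    odd-value : ∀ {p d} → Prime p → ¬ (p ∣ 2 * N) → 2 ≤ d → ¬ (2 ∣ ∣ a (p ^ (d ∸ 1)) ∣) →
      ¬ (2 ∣ d) × ∃₂ λ P Q → ∃[ b ] ∣ Q ∣ ≡ b * b × 2 ≤ b × a (p ^ (d ∸ 1)) ≡ U P Q d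
    odd-value {p} {suc zero} _ _ (s≤s ())
    odd-value {p} {d@(suc r@(suc r-1))} p-prime p∤2N 2≤d odd
      with ε , χp≈ε , ε-cases ← quadratic-value χ χ-quadratic (+ p) = go ε-cases
      where
      P = a p
      Q = ε ℤ.* (+ p) ℤ.^ (k ∸ 1)
      a≡U : a (p ^ r) ≡ U P Q d
      a≡U = a[p^r]≡U p-prime χp≈ε r
      2∣P : + 2 ℤ.∣ P
      2∣P = ℤ.∣ᵤ⇒∣ (even p p-prime p∤2N)
      even-U : + 2 ℤ.∣ U P Q d → 2 ∣ ∣ a (p ^ r) ∣
      even-U 2∣U = subst (λ x → 2 ∣ ∣ x ∣) (sym a≡U) (ℤ.∣⇒∣ᵤ 2∣U)
      abs-p^ : ∀ n → ∣ (+ p) ℤ.^ n ∣ ≡ p ^ n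
      abs-p^ zero    = refl
      abs-p^ (suc n) = trans (ℤ.abs-* (+ p) ((+ p) ℤ.^ n)) (cong (p *_) (abs-p^ n))
      2∤d : ¬ (2 ∣ d)
      2∤d (divides h d≡h*2) = odd (even-U
        (subst (λ n → + 2 ℤ.∣ U P Q n) (sym d≡h*2) (U-even P Q 2∣P h)))
      go : ε ≡ 0ℤ ⊎ ∣ ε ∣ ≡ 1 →
        ¬ (2 ∣ d) × ∃₂ λ P Q → ∃[ b ] ∣ Q ∣ ≡ b * b × 2 ≤ b × a (p ^ r) ≡ U P Q d
      go (inj₁ ε≡0) = contradiction (even-U (∣P∧∣Q⇒∣U P Q 2∣P 2∣Q r-1)) odd
        where
        2∣Q : + 2 ℤ.∣ Q
        2∣Q = ℤ.∣m⇒∣m*n ((+ p) ℤ.^ (k ∸ 1)) (subst (+ 2 ℤ.∣_) (sym ε≡0) (ℤ.divides 0ℤ refl))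
      -- Writing k = 3 + 2t gives pᵏ⁻¹ = (pᵗ⁺¹)², so b = pᵗ⁺¹.
      go (inj₂ ∣ε∣≡1) with t , refl ← odd⇒3+2t k 2∤k (ℕ.<⇒≤ 3≤k) = 2∤d , P , Q , p ^ suc t ,
        (begin
          ∣ ε ℤ.* (+ p) ℤ.^ (suc t * 2) ∣       ≡⟨ ℤ.abs-* ε ((+ p) ℤ.^ (suc t * 2)) ⟩
          ∣ ε ∣ * ∣ (+ p) ℤ.^ (suc t * 2) ∣     ≡⟨ cong₂ _*_ ∣ε∣≡1 (abs-p^ (suc t * 2)) ⟩
          1 * p ^ (suc t * 2)                   ≡⟨ ℕ.*-identityˡ (p ^ (suc t * 2)) ⟩
          p ^ (suc t * 2)                       ≡⟨ ℕ.^-*-assoc p (suc t) 2 ⟨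
          (p ^ suc t) ^ 2                       ≡⟨ cong (p ^ suc t *_) (ℕ.*-identityʳ (p ^ suc t)) ⟩
          p ^ suc t * p ^ suc t                 ∎) ,
        2≤m^[1+n] (nonTrivial⇒n>1 p ⦃ prime⇒nonTrivial p-prime ⦄) t , a≡U
        where open ≡-Reasoning

    ∣a[p^[d-1]]∣≢1 : ∀ p d → Prime p → ¬ (p ∣ 2 * N) → 2 ≤ d → ∣ a (p ^ (d ∸ 1)) ∣ ≢ 1
    ∣a[p^[d-1]]∣≢1 p d p-prime p∤2N 2≤d unit =
      let 2∤d , P , Q , b , ∣Q∣≡b² , 2≤b , a≡U = odd-value p-prime p∤2N 2≤d
            (λ 2∣a → contradiction (∣1⇒≡1 (subst (2 ∣_) unit 2∣a)) λ ())
      in ∣U-odd-index∣≢1 P Q d ∣Q∣≡b² 2≤b 2∤d 2≤d (trans (cong ∣_∣ (sym a≡U)) unit)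

    -- n = pᵉ m with p ∤ m, indexed by d = e + 1
    prime-power-part : ∀ n → 1 < n → Coprime n (2 * N) → ∃₂ λ p d → ∃[ m ]
      Prime p × ¬ (p ∣ 2 * N) × 2 ≤ d × 1 ≤ m × Coprime m (2 * N) × n ≡ p ^ (d ∸ 1) * m ×
      ∣ a n ∣ ≡ ∣ a (p ^ (d ∸ 1)) ∣ * ∣ a m ∣
    prime-power-part n 1<n n⊥2N with p , p-prime , p∣n ← prime-divisor 1<n
      with split-prime-power p-prime n (ℕ.<⇒≤ 1<n)
    ... | zero  , m , n≡m , p∤m = contradiction (subst (p ∣_) (trans n≡m (ℕ.*-identityˡ m)) p∣n) p∤m
    ... | suc e , m , n≡p^e*m , p∤m =
      p , suc (suc e) , m , p-prime , p∤2N , s≤s (s≤s z≤n) , 1≤m m p∤m , m⊥2N , n≡p^e*m , product≡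
      where
      p∤2N : ¬ (p ∣ 2 * N)
      p∤2N p∣2N = ℕ.<⇒≢ (nonTrivial⇒n>1 p ⦃ prime⇒nonTrivial p-prime ⦄) (sym (n⊥2N (p∣n , p∣2N)))
      m⊥2N : Coprime m (2 * N)
      m⊥2N (i∣m , i∣2N) = n⊥2N (subst (_ ∣_) (sym n≡p^e*m) (∣n⇒∣m*n (p ^ suc e) i∣m) , i∣2N)
      product≡ : ∣ a n ∣ ≡ ∣ a (p ^ suc e) ∣ * ∣ a m ∣
      product≡ = begin
        ∣ a n ∣                          ≡⟨ cong (∣_∣ ∘ a) n≡p^e*m ⟩
        ∣ a (p ^ suc e * m) ∣            ≡⟨ cong ∣_∣ (a-multiplicative newform (p ^ suc e) m
                                              (ℕ.m^n>0 p ⦃ prime⇒nonZero p-prime ⦄ (suc e))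
                                              (coprime⇒gcd≡1 (prime∤⇒coprime-^ p-prime p∤m (suc e)))) ⟩
        ∣ a (p ^ suc e) ℤ.* a m ∣        ≡⟨ ℤ.abs-* (a (p ^ suc e)) (a m) ⟩
        ∣ a (p ^ suc e) ∣ * ∣ a m ∣      ∎
        where open ≡-Reasoning
      1≤m : ∀ m → ¬ (p ∣ m) → 1 ≤ m
      1≤m zero    p∤0 = contradiction (p ∣0) p∤0
      1≤m (suc _) _   = s≤s z≤n

    -- If |a(n)| = 1, every factor is 1 in absolute value, including the one at a prime power.
    ∣a[n]∣≢1 : ∀ n → 1 < n → Coprime n (2 * N) → ∣ a n ∣ ≢ 1
    ∣a[n]∣≢1 n 1<n n⊥2N unit =
      let p , d , m , p-prime , p∤2N , 2≤d , _ , _ , _ , product≡ = prime-power-part n 1<n n⊥2N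
      in ∣a[p^[d-1]]∣≢1 p d p-prime p∤2N 2≤d
           (ℕ.m*n≡1⇒m≡1 ∣ a (p ^ (d ∸ 1)) ∣ ∣ a m ∣ (trans (sym product≡) unit))

    -- In ℓ = |a(pᵈ⁻¹)| |a(m)| the first factor is not 1, so it is ℓ and |a(m)| = 1. By `∣a[n]∣≢1`
    -- this forces m = 1, and the results on Lucas terms of prime absolute value apply to a(pᵈ⁻¹).
    prime-value : ∀ n ℓ → 1 < n → Coprime n (2 * N) → Prime ℓ → ℓ ≢ 2 → ∣ a n ∣ ≡ ℓ →
      ∃₂ λ p d → Prime p × ¬ (2 ∣ d) × d ∣ ℓ * (ℓ ^ 2 ∸ 1) × n ≡ p ^ (d ∸ 1) × Prime d
    prime-value n ℓ 1<n n⊥2N ℓ-prime ℓ≢2 ∣an∣≡ℓ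
      with p , d , m , p-prime , p∤2N , 2≤d , 1≤m , m⊥2N , n≡p^*m , product≡ ← prime-power-part n 1<n n⊥2N
      with prime⇒irreducible ℓ-prime (divides ∣ a m ∣
             (trans (sym ∣an∣≡ℓ) (trans product≡ (ℕ.*-comm (∣ a (p ^ (d ∸ 1)) ∣) ∣ a m ∣))))
    ... | inj₁ unit = contradiction unit (∣a[p^[d-1]]∣≢1 p d p-prime p∤2N 2≤d)
    ... | inj₂ ∣ap∣≡ℓ =
      let 2∤d , P , Q , b , ∣Q∣≡b² , 2≤b , a≡U =
            odd-value p-prime p∤2N 2≤d (2∤prime ℓ-prime ℓ≢2 ∘ subst (2 ∣_) ∣ap∣≡ℓ)
          ∣U∣≡ℓ = trans (cong ∣_∣ (sym a≡U)) ∣ap∣≡ℓ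
      in p , d , p-prime , 2∤d , ∣U∣prime⇒index∣ P Q ∣Q∣≡b² 2≤b ℓ-prime ℓ≢2 2∤d 2≤d ∣U∣≡ℓ ,
         trans n≡p^*m (trans (cong (p ^ (d ∸ 1) *_) m≡1) (ℕ.*-identityʳ (p ^ (d ∸ 1)))) ,
         ∣U∣prime⇒prime-index P Q ∣Q∣≡b² 2≤b ℓ-prime 2∤d 2≤d ∣U∣≡ℓ
      where
      ∣am∣≡1 : ∣ a m ∣ ≡ 1
      ∣am∣≡1 = ℕ.*-cancelˡ-≡ _ 1 ℓ ⦃ prime⇒nonZero ℓ-prime ⦄
        (trans (cong (_* ∣ a m ∣) (sym ∣ap∣≡ℓ)) (trans (sym product≡) (trans ∣an∣≡ℓ (sym (ℕ.*-identityʳ ℓ)))))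
      m≡1 : m ≡ 1
      m≡1 with ℕ.m≤n⇒m<n∨m≡n 1≤m
      ... | inj₁ 1<m = contradiction ∣am∣≡1 (∣a[n]∣≢1 m 1<m m⊥2N)
      ... | inj₂ 1≡m = sym 1≡m

theorem1p5 : (k N : ℕ) → 3 ≤ k → ¬ (2 ∣ k) → 1 ≤ N →
    (χ : DirichletCharacter N) → IsQuadratic χ →
    (f : ℍ → ℂ) (a : ℕ → ℤ) → IsNewform k N χ f (λ n → intᶜ (a n)) →
    TrivialResidualMod2 N a →
    (∀ p d → Prime p → ¬ (p ∣ 2 * N) → 2 ≤ d → ∣ a (p ^ (d ∸ 1)) ∣ ≢ 1)
    ×
    (∀ n → 1 < n → Coprime n (2 * N) → ∣ a n ∣ ≢ 1)
    ×
    (∀ n ℓ → 1 < n → Coprime n (2 * N) → Prime ℓ → ℓ ≢ 2 → ∣ a n ∣ ≡ ℓ →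
    ∃₂ λ p d → Prime p × ¬ (2 ∣ d) × d ∣ ℓ * (ℓ ^ 2 ∸ 1) × n ≡ p ^ (d ∸ 1) ×
    ((α β : ℂ) → AreHeckeRoots k χ a p α β → ¬ IsDefective α β d →
    Prime d × ¬ (2 ∣ d)))
theorem1p5 k N 3≤k 2∤k _ χ χ-quadratic f a newform even =
  ∣a[p^[d-1]]∣≢1 newform 3≤k 2∤k χ-quadratic even ,
  ∣a[n]∣≢1 newform 3≤k 2∤k χ-quadratic even ,
  λ n ℓ 1<n n⊥2N ℓ-prime ℓ≢2 ∣an∣≡ℓ →
    let p , d , p-prime , 2∤d , d∣ , n≡p^ , d-prime =
          prime-value newform 3≤k 2∤k χ-quadratic even n ℓ 1<n n⊥2N ℓ-prime ℓ≢2 ∣an∣≡ℓ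
    in p , d , p-prime , 2∤d , d∣ , n≡p^ , λ _ _ _ _ → d-prime , 2∤d
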